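{- The following decision problem is undecidable: given a nonempty finite set $\mathcal{P}$ of processes and an HMSC $\mathcal{H}=(S,\iota,\mathit{Msg},R,F,F_\omega)$ over $\mathcal{P}$ such that $\mathit{Msg}$ is a singleton set, decide whether $L(\mathcal{H})\neq\emptyset$.
   Context: Let $\mathcal{P}$ be a nonempty finite set of processes, $\mathit{Ch}=\{(p,q)\in\mathcal{P}\times\mathcal{P}\mid p\neq q\}$, $\mathit{Act}_p=\{p!q\mid (p,q)\in\mathit{Ch}\}\cup\{p?q\mid (q,p)\in\mathit{Ch}\}$, $\mathit{Act}=\bigcup_p\mathit{Act}_p$, and $\mathit{Msg}$ a finite set of messages. A compositional MSC (cMSC) over $\mathcal{P}$ and $\mathit{Msg}$ is a tuple $M=(E,\le,\lhd,\lambda,\mu)$ where $E$ is a nonempty finite or countably infinite set of events, $\le$ a partial order on $E$, $\lambda\colon E\to\mathit{Act}$, $\mu\colon E\rightharpoonup\mathit{Msg}$ partial, such that: for each $p$, with $E_p=\{e\mid\lambda(e)\in\mathit{Act}_p\}$, the restriction $\le_p$ of $\le$ to $E_p$ is a total order, finite or isomorphic to $(\mathbb{N},\le)$; with ${\to}$ the union over $p$ of the direct-successor relations of $\le_p$, the relation ${\lhd}\subseteq{\le}$ satisfies (i) each $(e,f)\in\lhd$ has $\lambda(e)=p!q$, $\lambda(f)=q?p$ for some $(p,q)\in\mathit{Ch}$, (ii) FIFO: for $(e,f),(e',f')\in\lhd$ with $e,e'\in E_p$, $f,f'\in E_q$, $e\le_p e'$ iff $f\le_q f'$; $\le$ is the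 reflexive transitive closure of ${\to}\cup{\lhd}$; with $\mathrm{unm}(M)$ the set of events not related by $\lhd$ to any event, $\mathrm{dom}(\mu)=\mathrm{unm}(M)$; and for all $(e,f)\in\lhd$, $g\in\mathrm{unm}(M)$: $\lambda(g)=\lambda(e)\Rightarrow e<g$ and $\lambda(g)=\lambda(f)\Rightarrow g<f$. $M$ is an MSC if $\mathrm{unm}(M)=\emptyset$; $\mathbb{MSC}$ is the set of MSCs, $\mathrm{fc}\mathbb{MSC}$ the set of finite cMSCs. Concatenation: for $M_1\in\mathrm{fc}\mathbb{MSC}$ and a cMSC $M_2$, $M_1\circ M_2$ is the set of all cMSCs $M$ with $E=E^1\uplus E^2$, ${\le_p}={\le^1_p}\cup{\le^2_p}\cup(E^1_p\times E^2_p)$ for all $p$, ${\lhd^1}\cup{\lhd^2}\subseteq{\lhd}$ and every other pair $(e,f)\in\lhd$ has $e\in E^1$, $f\in E^2$, $\mu^1(e)=\mu^2(f)$, and labels $\lambda$ (and $\mu$ on unmatched events of $M$) inherited from $M_1,M_2$. The infinite product $\prod_{i\ge1}M_i$ of finite cMSCs is defined analogously (new message edges go from $M_i$ to $M_j$ with $i<j$ and equal messages). An HMSC over $\mathcal{P}$ is $\mathcal{H}=(S,\iota,\mathit{Msg},R,F,F_\omega)$ with finite $S$, $\iota\in S$, finite $\mathit{Msg}$, finite $R\subseteq S\times\mathrm{fc}\mathbb{MSC}\times S$, and $F,F_\omega\subseteq S$. A finite path is $\rho=s_0M_1s_1\cdots M_ns_n$ ($n\ge1$, $(s_{i-1},M_i,s_i)\in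 R$), infinite paths analogous; $\mathit{cmscs}(\rho)=M_1\circ\cdots\circ M_n$ (resp. $\prod_i M_i$). A path is accepting if it starts at $\iota$ and is finite ending in $F$, or infinite visiting $F_\omega$ infinitely often. $L(\mathcal{H})=\bigcup\{\mathit{cmscs}(\rho)\mid\rho\text{ accepting}\}\cap\mathbb{MSC}$. -}

module Defs where

open import Level using (Level; 0ℓ) renaming (suc to lsuc)
open import Data.Nat using (ℕ; zero; suc; _<_) renaming (_≤_ to _≤ℕ_)
open import Data.Fin using (Fin) renaming (zero to fzero)
open import Data.Bool using (Bool; true; false; T; not)
open import Data.Maybe using (Maybe; just; nothing; _>>=_)
open import Data.Unit using (⊤; tt)
open import Data.Empty using (⊥)
open import Data.Product using (Σ; ∃; ∃₂; _×_; _,_; proj₁; proj₂)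
open import Data.Sum using (_⊎_; inj₁; inj₂)
open import Data.List using (List; []; _∷_)
open import Data.List.Membership.Propositional using (_∈_)
open import Relation.Binary.PropositionalEquality using (_≡_; _≢_)
open import Relation.Nullary using (¬_)
open import Relation.Binary.Structures using (IsPartialOrder)
open import Relation.Binary.Construct.Closure.ReflexiveTransitive using (Star)
open import Function.Bundles using (_↔_; _⇔_; Inverse)

-- Processes are Fin k (the theorem uses Fin (suc k): nonempty, finite).
-- Actions Act = { p!q } ∪ { p?q } with p ≠ q.
--   send p q _  is  p!q   (p sends to q; belongs to Act_p)
--   recv p q _  is  p?q   (p receives from q; belongs to Act_p)
-- The proof of distinctness is irrelevant, so equality of actions is
-- equality of the labels.

data Act (k : ℕ) : Set where
  send : (p q : Fin k) → .(p ≢ q) → Act k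
  recv : (p q : Fin k) → .(q ≢ p) → Act k

-- the process an action belongs to (a ∈ Act_p iff owner a ≡ p)
owner : ∀ {k} → Act k → Fin k
owner (send p q _) = p
owner (recv p q _) = p

-- cMSC axioms for an event type E with labelling, order, message
-- relation and partial message map μ : E ⇀ Msg (as E → Maybe Msg).

module _ {k : ℕ} {Msg : Set} (E : Set) (lab : E → Act k)
         (_≤_ _⊲_ : E → E → Set) (μ : E → Maybe Msg) where

  Ev : Fin k → Set
  Ev p = Σ E (λ e → owner (lab e) ≡ p)

  _<E_ : E → E → Set
  e <E f = e ≤ f × e ≢ f

  DSucc : E → E → Set
  DSucc e f = owner (lab e) ≡ owner (lab f) × e <E f
            × (∀ g → owner (lab g) ≡ owner (lab e) → e ≤ g → g ≤ f → g ≡ e ⊎ g ≡ f)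

  Step : E → E → Set
  Step e f = DSucc e f ⊎ e ⊲ f

  Unm : E → Set
  Unm e = ¬ (Σ E λ f → e ⊲ f ⊎ f ⊲ e)

  record IsCMSC : Set where
    field
      nonempty     : E
      countable    : (Σ ℕ λ n → Fin n ↔ E) ⊎ (ℕ ↔ E)
      partialOrder : IsPartialOrder _≡_ _≤_
      totalₚ       : ∀ e f → owner (lab e) ≡ owner (lab f) → e ≤ f ⊎ f ≤ e
      shapeₚ       : ∀ p → (Σ ℕ λ n → Fin n ↔ Ev p)
                         ⊎ (Σ (ℕ ↔ Ev p) λ g → ∀ m n →
                              (m ≤ℕ n) ⇔ (proj₁ (Inverse.to g m) ≤ proj₁ (Inverse.to g n)))
      ⊲⊆≤          : ∀ e f → e ⊲ f → e ≤ f
      ⊲-labels     : ∀ e f → e ⊲ f →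
                       ∃₂ λ p q → Σ (p ≢ q) λ d → lab e ≡ send p q d × lab f ≡ recv q p d
      fifo         : ∀ e f e' f' → e ⊲ f → e' ⊲ f' →
                       owner (lab e) ≡ owner (lab e') → owner (lab f) ≡ owner (lab f') →
                       (e ≤ e') ⇔ (f ≤ f')
      ≤-closure    : ∀ e f → (e ≤ f) ⇔ Star Step e f
      dom-μ        : ∀ e → (∃ λ m → μ e ≡ just m) ⇔ Unm e
      unm-order    : ∀ e f g → e ⊲ f → Unm g →
                       (lab g ≡ lab e → e <E g) × (lab g ≡ lab f → g <E f)

record CMSC (k : ℕ) (Msg : Set) (E : Set) : Set₁ where
  field
    lab    : E → Act k
    _≤_    : E → E → Set
    _⊲_    : E → E → Set
    μ      : E → Maybe Msg
    isCMSC : IsCMSC E lab _≤_ _⊲_ μ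

IsMSC : ∀ {k Msg E} → CMSC k Msg E → Set
IsMSC {E = E} M = ∀ e → ¬ Unm E lab _≤_ _⊲_ μ e
  where open CMSC M

-- finite cMSCs, given as concrete (decidable) data on events Fin n
record FCMSC (k : ℕ) (Msg : Set) : Set where
  field
    n     : ℕ
    lab   : Fin n → Act k
    le    : Fin n → Fin n → Bool
    msg   : Fin n → Fin n → Bool
    μ     : Fin n → Maybe Msg
    valid : IsCMSC (Fin n) lab (λ a b → T (le a b)) (λ a b → T (msg a b)) μ

toCMSC : ∀ {k Msg} (M : FCMSC k Msg) → CMSC k Msg (Fin (FCMSC.n M))
toCMSC M = record { lab = lab ; _≤_ = λ a b → T (le a b) ; _⊲_ = λ a b → T (msg a b)
                  ; μ = μ ; isCMSC = valid }
  where open FCMSC M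

-- Concatenation: X ∈ M₁ ∘ M₂ (events Fin n₁ ⊎ E₂)

module _ {k : ℕ} {Msg : Set} (M₁ : FCMSC k Msg) {E₂ : Set} (M₂ : CMSC k Msg E₂) where
  private
    module A = FCMSC M₁
    module B = CMSC M₂

  CatLe : Fin A.n ⊎ E₂ → Fin A.n ⊎ E₂ → Set
  CatLe (inj₁ a) (inj₁ b) = T (A.le a b)
  CatLe (inj₂ a) (inj₂ b) = a B.≤ b
  CatLe (inj₁ a) (inj₂ b) = ⊤
  CatLe (inj₂ a) (inj₁ b) = ⊥

  CatMsg : Fin A.n ⊎ E₂ → Fin A.n ⊎ E₂ → Set
  CatMsg (inj₁ a) (inj₁ b) = T (A.msg a b)
  CatMsg (inj₂ a) (inj₂ b) = a B.⊲ b
  CatMsg (inj₁ a) (inj₂ b) = ∃ λ m → A.μ a ≡ just m × B.μ b ≡ just m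
  CatMsg (inj₂ a) (inj₁ b) = ⊥

  CatLab : Fin A.n ⊎ E₂ → Act k
  CatLab (inj₁ a) = A.lab a
  CatLab (inj₂ b) = B.lab b

  CatMu : Fin A.n ⊎ E₂ → Maybe Msg
  CatMu (inj₁ a) = A.μ a
  CatMu (inj₂ b) = B.μ b

  record Concat (X : CMSC k Msg (Fin A.n ⊎ E₂)) : Set where
    open CMSC X
    field
      lab-inh : ∀ x → lab x ≡ CatLab x
      ≤ₚ      : ∀ x y → owner (lab x) ≡ owner (lab y) → (x ≤ y) ⇔ CatLe x y
      old₁    : ∀ a b → T (A.msg a b) → inj₁ a ⊲ inj₁ b
      old₂    : ∀ a b → a B.⊲ b → inj₂ a ⊲ inj₂ b
      others  : ∀ x y → x ⊲ y → CatMsg x y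
      μ-inh   : ∀ x → Unm (Fin A.n ⊎ E₂) lab _≤_ _⊲_ μ x → μ x ≡ CatMu x

-- M₁ ∘ (M₂ ∘ (⋯ ∘ Mₙ)) for a nonempty list M₁ ∷ ms
EvList : ∀ {k Msg} → FCMSC k Msg → List (FCMSC k Msg) → Set
EvList M []        = Fin (FCMSC.n M)
EvList M (M' ∷ ms) = Fin (FCMSC.n M) ⊎ EvList M' ms

InCat : ∀ {k Msg} (M : FCMSC k Msg) (ms : List (FCMSC k Msg)) →
        CMSC k Msg (EvList M ms) → Set₁
InCat M []        X = X ≡ toCMSC M
InCat M (M' ∷ ms) X = Σ (CMSC _ _ (EvList M' ms)) λ Y → InCat M' ms Y × Concat M Y X

-- Infinite product ∏_{i} Mᵢ (indices from 0), events Σ i, Fin nᵢ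

module _ {k : ℕ} {Msg : Set} (ℳ : ℕ → FCMSC k Msg) where
  IEv : Set
  IEv = Σ ℕ λ i → Fin (FCMSC.n (ℳ i))

  data ProdLe : IEv → IEv → Set where
    diff : ∀ {i j a b} → i < j → ProdLe (i , a) (j , b)
    same : ∀ {i a b} → T (FCMSC.le (ℳ i) a b) → ProdLe (i , a) (i , b)

  data ProdMsg : IEv → IEv → Set where
    old : ∀ {i a b} → T (FCMSC.msg (ℳ i) a b) → ProdMsg (i , a) (i , b)
    new : ∀ {i j a b} (m : Msg) → i < j →
          FCMSC.μ (ℳ i) a ≡ just m → FCMSC.μ (ℳ j) b ≡ just m → ProdMsg (i , a) (j , b)

  record InProd (X : CMSC k Msg IEv) : Set where
    open CMSC X
    field
      lab-inh : ∀ i a → lab (i , a) ≡ FCMSC.lab (ℳ i) a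
      ≤ₚ      : ∀ x y → owner (lab x) ≡ owner (lab y) → (x ≤ y) ⇔ ProdLe x y
      old⊆    : ∀ i a b → T (FCMSC.msg (ℳ i) a b) → (i , a) ⊲ (i , b)
      others  : ∀ x y → x ⊲ y → ProdMsg x y
      μ-inh   : ∀ i a → Unm IEv lab _≤_ _⊲_ μ (i , a) → μ (i , a) ≡ FCMSC.μ (ℳ i) a

record HMSC (k : ℕ) : Set where
  field
    nS  : ℕ
    ι   : Fin nS
    R   : List (Fin nS × FCMSC k ⊤ × Fin nS)
    F   : Fin nS → Bool
    Fω  : Fin nS → Bool

module _ {k : ℕ} (H : HMSC k) where
  open HMSC H

  data FPath : Fin nS → Fin nS → Set where
    one  : ∀ {s M s'} → (s , M , s') ∈ R → FPath s s'
    step : ∀ {s M s₁ s₂} → (s , M , s₁) ∈ R → FPath s₁ s₂ → FPath s s₂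

  first : ∀ {s s'} → FPath s s' → FCMSC k ⊤
  first (one {M = M} _)    = M
  first (step {M = M} _ _) = M

  rest : ∀ {s s'} → FPath s s' → List (FCMSC k ⊤)
  rest (one _)    = []
  rest (step _ ρ) = first ρ ∷ rest ρ

  record IPath : Set where
    field
      σ     : ℕ → Fin nS
      ℳ     : ℕ → FCMSC k ⊤
      trans : ∀ i → (σ i , ℳ i , σ (suc i)) ∈ R

  NonEmptyLang : Set₁
  NonEmptyLang =
      (Σ (Fin nS) λ s → T (F s) × Σ (FPath ι s) λ ρ →
         Σ (CMSC k ⊤ (EvList (first ρ) (rest ρ))) λ X → InCat (first ρ) (rest ρ) X × IsMSC X)
    ⊎ (Σ IPath λ π → IPath.σ π 0 ≡ ι
         × (∀ i → ∃ λ j → i ≤ℕ j × T (Fω (IPath.σ π j)))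
         × Σ (CMSC k ⊤ (IEv (IPath.ℳ π))) λ X → InProd (IPath.ℳ π) X × IsMSC X)

Instance : Set
Instance = Σ ℕ λ k → HMSC (suc k)

HMSCNonEmpty : Instance → Set₁
HMSCNonEmpty (k , H) = NonEmptyLang H

-- Turing machines (binary tape, blank = false), started on blank tape
-- in state 0; halting problem on blank tape (undecidable).

data Dir : Set where
  L R : Dir

record TM : Set where
  field
    Q : ℕ
    δ : Fin (suc Q) → Bool → Maybe (Fin (suc Q) × Bool × Dir)   -- nothing = halt

record Config (M : TM) : Set where
  constructor cfg
  field
    state : Fin (suc (TM.Q M))
    left  : List Bool      -- cells left of the head, nearest first
    head  : Bool
    right : List Bool      -- cells right of the head, nearest first

move : ∀ {M} → Fin (suc (TM.Q M)) → Bool → Dir → Config M → Config M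
move q b L (cfg _ []       _ r) = cfg q [] false (b ∷ r)
move q b L (cfg _ (x ∷ l)  _ r) = cfg q l x (b ∷ r)
move q b R (cfg _ l _ [])       = cfg q (b ∷ l) false []
move q b R (cfg _ l _ (x ∷ r))  = cfg q (b ∷ l) x r

stepTM : ∀ {M} → Config M → Maybe (Config M)
stepTM {M} c with TM.δ M (Config.state c) (Config.head c)
... | nothing            = nothing
... | just (q , b , d)   = just (move q b d c)

iterTM : ∀ {M} → ℕ → Config M → Maybe (Config M)
iterTM zero    c = just c
iterTM (suc n) c = stepTM c >>= iterTM n

initial : (M : TM) → Config M
initial M = cfg fzero [] false []

Halts : TM → Set
Halts M = ∃ λ n → ∃ λ c → iterTM n (initial M) ≡ just c
                       × TM.δ M (Config.state c) (Config.head c) ≡ nothing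

-- Minsky's route through three-counter machines. A Turing machine on blank tape is simulated by a
-- counter machine whose counters hold the binary values of the two tape halves and a scratch value;
-- once the Turing machine halts, the counters are drained to zero and a final state is entered.
-- A counter machine becomes an HMSC over six processes in which counter c is a channel between
-- two processes of its own: an increment is a lone send, a decrement a lone receive, and a zero
-- test a send matched by a receive inside the same block, all messages being equal. By FIFO the
-- i-th send on a channel can only be matched with the i-th receive, so the blocks along a path
-- form an MSC exactly when no receive overtakes the sends of its channel, every channel is empty
-- at each of its zero tests and at the end: that is, when the path is a run of the counter machine
-- from and back to zero counters. Infinite paths never accept, as no state is Büchi-accepting.

module Submission where

open import Defs
open import Data.Product using (Σ; proj₂)
open import Function.Bundles using (_⇔_)

open import Axiom.UniquenessOfIdentityProofs using (module Decidable⇒UIP)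
open import Data.Bool using (Bool; true; false; T; if_then_else_)
open import Data.Empty using (⊥; ⊥-elim)
open import Data.Fin as Fin using (Fin; toℕ; fromℕ<; combine; remQuot) renaming (zero to fzero; suc to fsuc)
open import Data.Fin.Properties
  using (any?; remQuot-combine; toℕ-injective; toℕ<n; toℕ-fromℕ<; toℕ-↑ˡ; toℕ-↑ʳ; +↔⊎; combine-injectiveˡ; combine-injectiveʳ)
open import Data.Maybe using (Maybe; just; nothing)
open import Data.Maybe.Properties using (just-injective) renaming (≡-dec to ≡-decMaybe)
open import Data.Unit using (⊤; tt)
open import Data.List using (List; []; _∷_; _++_; length; lookup; map; concatMap; allFin)
open import Data.List.Membership.Propositional using (_∈_; find; lose)
open import Data.List.Relation.Unary.Any using (here; there)
open import Data.List.Membership.Propositional.Properties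
  using (∈-map⁺; ∈-map⁻; ∈-concatMap⁺; ∈-concatMap⁻; ∈-allFin)
open import Data.List.Properties using (length-++; ++-assoc; ++-identityʳ; ∷-injective)
open import Data.Nat using (ℕ; zero; suc; _+_; _*_; _<_; _≤_; z≤n; s≤s; _<?_; _≤?_; _≤ᵇ_)
open import Data.Nat.Properties
open import Data.Product using (∃; ∃₂; _×_; _,_; proj₁)
open import Data.Product.Function.Dependent.Propositional using (Σ-↔)
open import Data.Sum using (_⊎_; inj₁; inj₂)
open import Data.Sum.Function.Propositional using (_⊎-↔_)
open import Function using (_∘_; case_of_)
open import Function.Bundles using (_↔_; Inverse; mk⇔; mk↔ₛ′; Equivalence)
open import Function.Construct.Identity using (↔-id; ⇔-id)
open import Function.Properties.Inverse using (↔-trans; ↔-sym)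
open import Function.Properties.Equivalence using () renaming (trans to ⇔-trans; sym to ⇔-sym)
open import Relation.Binary.Construct.Closure.ReflexiveTransitive using (Star; ε; _◅_; _◅◅_; _⋆)
open import Relation.Binary.PropositionalEquality
open import Relation.Nullary using (¬_; Dec; yes; no; Irrelevant)
import Relation.Nullary.Decidable as Dec
open import Relation.Nullary.Decidable using (does; dec-true; dec-false; decidable-stable; _×-dec_; _⊎-dec_)
open import Relation.Binary.Definitions using (DecidableEquality; tri<; tri≈; tri>)
open import Relation.Unary using (Decidable)
open import Algebra.Properties.CommutativeSemigroup +-commutativeSemigroup using (x∙yz≈y∙xz)

-- Least witnesses and decidable subsets of Fin

module _ {p} (P : ℕ → Set p) (P? : Decidable P) where

  LeastAbove : ℕ → ℕ → Set p
  LeastAbove a b = ∃ λ m → a < m × m ≤ b × P m × (∀ {j} → a < j → j < m → ¬ P j)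

  leastAbove : ∀ {a b} → a < b → P b → LeastAbove a b
  leastAbove {a} {b} = search b (m≤m+n b a)
    where
    search : ∀ fuel {a} → b ≤ fuel + a → a < b → P b → LeastAbove a b
    search zero    b≤a a<b _ = ⊥-elim (<⇒≱ a<b b≤a)
    search (suc fuel) {a} b≤ a<b pb with P? (suc a) | m≤n⇒m<n∨m≡n a<b
    ... | yes pa | _         = suc a , n<1+n a , a<b , pa , λ a<j j<1+a _ → <⇒≱ a<j (m<1+n⇒m≤n j<1+a)
    ... | no ¬pa | inj₂ refl = ⊥-elim (¬pa pb)
    ... | no ¬pa | inj₁ 1+a<b with search fuel (subst (b ≤_) (sym (+-suc fuel a)) b≤) 1+a<b pb
    ...   | m , 1+a<m , m≤b , pm , least = m , <-trans (n<1+n a) 1+a<m , m≤b , pm , below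
      where
      below : ∀ {j} → a < j → j < m → ¬ P j
      below a<j j<m with m≤n⇒m<n∨m≡n a<j
      ... | inj₁ 1+a<j = least 1+a<j j<m
      ... | inj₂ refl  = ¬pa

Σ-Fin-suc↔ : ∀ {n} (P : Fin (suc n) → Set) → Σ (Fin (suc n)) P ↔ (P fzero ⊎ Σ (Fin n) (P ∘ fsuc))
Σ-Fin-suc↔ P = mk↔ₛ′ to from to∘from from∘to
  where
  to : Σ (Fin _) P → P fzero ⊎ Σ (Fin _) (P ∘ fsuc)
  to (fzero  , p) = inj₁ p
  to (fsuc i , p) = inj₂ (i , p)
  from : P fzero ⊎ Σ (Fin _) (P ∘ fsuc) → Σ (Fin _) P
  from (inj₁ p)       = fzero , p
  from (inj₂ (i , p)) = fsuc i , p
  to∘from : ∀ y → to (from y) ≡ y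
  to∘from (inj₁ _) = refl
  to∘from (inj₂ _) = refl
  from∘to : ∀ x → from (to x) ≡ x
  from∘to (fzero  , _) = refl
  from∘to (fsuc _ , _) = refl

decSubset↔Fin : ∀ N (P : Fin N → Set) → Decidable P → (∀ {i} → Irrelevant (P i)) →
                ∃ λ n → Fin n ↔ Σ (Fin N) P
decSubset↔Fin zero    P _  _   = 0 , mk↔ₛ′ (λ ()) (λ { (() , _) }) (λ { (() , _) }) (λ ())
decSubset↔Fin (suc N) P P? irr with decSubset↔Fin N (P ∘ fsuc) (P? ∘ fsuc) irr | P? fzero
... | n , e | yes p = suc n , ↔-trans +↔⊎ (↔-trans (Fin1↔P ⊎-↔ e) (↔-sym (Σ-Fin-suc↔ P)))
  where
  Fin1↔P : Fin 1 ↔ P fzero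
  Fin1↔P = mk↔ₛ′ (λ _ → p) (λ _ → fzero) (irr p) λ { fzero → refl ; (fsuc ()) }
... | n , e | no ¬p = n , ↔-trans e (↔-sym (↔-trans (Σ-Fin-suc↔ P) skipEmpty))
  where
  skipEmpty : (P fzero ⊎ Σ (Fin N) (P ∘ fsuc)) ↔ Σ (Fin N) (P ∘ fsuc)
  skipEmpty = mk↔ₛ′ (λ { (inj₁ p) → ⊥-elim (¬p p) ; (inj₂ x) → x }) inj₂ (λ _ → refl)
                    (λ { (inj₁ p) → ⊥-elim (¬p p) ; (inj₂ _) → refl })

-- cMSCs from linearisations

module Linearisation {k : ℕ} {E : Set} {N : ℕ} (enum : Fin N ↔ E)
                     (lab : E → Act k) (_⊲_ : E → E → Set) where

  open Inverse enum using (to; from; strictlyInverseˡ; strictlyInverseʳ)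

  rank : E → ℕ
  rank = toℕ ∘ from

  rank-injective : ∀ {x y} → rank x ≡ rank y → x ≡ y
  rank-injective {x} {y} eq =
    trans (sym (strictlyInverseˡ x)) (trans (cong to (toℕ-injective eq)) (strictlyInverseˡ y))

  SameProc : E → E → Set
  SameProc x y = owner (lab x) ≡ owner (lab y)

  data Gen (x y : E) : Set where
    earlier : SameProc x y → rank x < rank y → Gen x y
    message : x ⊲ y → Gen x y

  module Ordered (⊲-increasing : ∀ {x y} → x ⊲ y → rank x < rank y) where

    gen-rank : ∀ {x y} → Gen x y → rank x < rank y
    gen-rank (earlier _ lt) = lt
    gen-rank (message m)    = ⊲-increasing m

    star-rank : ∀ {x y} → Star Gen x y → x ≡ y ⊎ rank x < rank y
    star-rank ε = inj₁ refl
    star-rank (g ◅ gs) with star-rank gs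
    ... | inj₁ refl = inj₂ (gen-rank g)
    ... | inj₂ lt   = inj₂ (<-trans (gen-rank g) lt)

    star⇒rank≤ : ∀ {x y} → Star Gen x y → rank x ≤ rank y
    star⇒rank≤ gs with star-rank gs
    ... | inj₁ refl = ≤-refl
    ... | inj₂ lt   = <⇒≤ lt

    rank≤⇒star : ∀ {x y} → SameProc x y → rank x ≤ rank y → Star Gen x y
    rank≤⇒star {x} {y} so le with m≤n⇒m<n∨m≡n le
    ... | inj₁ lt = earlier so lt ◅ ε
    ... | inj₂ eq with rank-injective {x} {y} eq
    ...   | refl = ε

    module Closure {Msg : Set} (_≼_ : E → E → Set) (≼⇔star : ∀ {x y} → x ≼ y ⇔ Star Gen x y)
                   (μ : E → Maybe Msg) where

      ≼⇒star : ∀ {x y} → x ≼ y → Star Gen x y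
      ≼⇒star = Equivalence.to ≼⇔star

      star⇒≼ : ∀ {x y} → Star Gen x y → x ≼ y
      star⇒≼ = Equivalence.from ≼⇔star

      ≼⇔rank≤ : ∀ {x y} → SameProc x y → x ≼ y ⇔ rank x ≤ rank y
      ≼⇔rank≤ so = mk⇔ (star⇒rank≤ ∘ ≼⇒star) (star⇒≼ ∘ rank≤⇒star so)

      rank<⇒<E : ∀ {x y} → SameProc x y → rank x < rank y → _<E_ E lab _≼_ _⊲_ μ x y
      rank<⇒<E so lt = star⇒≼ (earlier so lt ◅ ε) , λ eq → <-irrefl (cong rank eq) lt

      Step′ : E → E → Set
      Step′ = Step E lab _≼_ _⊲_ μ

      Unm′ : E → Set
      Unm′ = Unm E lab _≼_ _⊲_ μ

      OnProcAt : E → ℕ → Set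
      OnProcAt x j = ∃ λ e → rank e ≡ j × SameProc x e

      onProcAt? : ∀ x → Decidable (OnProcAt x)
      onProcAt? x j with j <? N
      ... | no  j≮N = no λ { (e , refl , _) → j≮N (toℕ<n (from e)) }
      ... | yes j<N = Dec.map′ (λ so → e , rank-e , so) sameAsE (owner (lab x) Fin.≟ owner (lab e))
        where
        e : E
        e = to (fromℕ< j<N)
        rank-e : rank e ≡ j
        rank-e = trans (cong toℕ (strictlyInverseʳ (fromℕ< j<N))) (toℕ-fromℕ< j<N)
        sameAsE : OnProcAt x j → SameProc x e
        sameAsE (e′ , r , so) = subst (SameProc x) (rank-injective (trans r (sym rank-e))) so

      -- the event of least rank above x on its process is the direct successor of x
      sameProc⇒steps : ∀ {x y} → SameProc x y → rank x < rank y → Star Step′ x y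
      sameProc⇒steps {x} {y} = go (rank y) (m≤m+n (rank y) (rank x))
        where
        go : ∀ fuel {x y} → rank y ≤ fuel + rank x → SameProc x y → rank x < rank y → Star Step′ x y
        go zero       y≤x _  x<y = ⊥-elim (<⇒≱ x<y y≤x)
        go (suc fuel) {x} {y} y≤ so x<y
          with leastAbove (OnProcAt x) (onProcAt? x) x<y (y , refl , so)
        ... | _ , x<e , e≤y , (e , refl , soe) , least = inj₁ (soe , rank<⇒<E soe x<e , between) ◅ onward
          where
          between : ∀ g → owner (lab g) ≡ owner (lab x) → x ≼ g → g ≼ e → g ≡ x ⊎ g ≡ e
          between g og xg ge with star-rank (≼⇒star xg)
          ... | inj₁ refl = inj₁ refl
          ... | inj₂ x<g with star-rank (≼⇒star ge)
          ...   | inj₁ refl = inj₂ refl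
          ...   | inj₂ g<e  = ⊥-elim (least x<g g<e (g , refl , sym og))
          onward : Star Step′ e y
          onward with m≤n⇒m<n∨m≡n e≤y
          ... | inj₂ e≡y = subst (Star Step′ e) (rank-injective e≡y) ε
          ... | inj₁ e<y = go fuel (≤-trans y≤ (≤-trans (≤-reflexive (sym (+-suc fuel (rank x))))
                                                          (+-monoʳ-≤ fuel x<e)))
                              (trans (sym soe) so) e<y

      ≼⇔steps : ∀ {x y} → x ≼ y ⇔ Star Step′ x y
      ≼⇔steps = mk⇔ ((genToSteps ⋆) ∘ ≼⇒star) (star⇒≼ ∘ (stepToGens ⋆))
        where
        genToSteps : ∀ {x y} → Gen x y → Star Step′ x y
        genToSteps (earlier so lt) = sameProc⇒steps so lt
        genToSteps (message m)     = inj₂ m ◅ ε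
        stepToGens : ∀ {x y} → Step′ x y → Star Gen x y
        stepToGens (inj₁ (_ , (x≼y , _) , _)) = ≼⇒star x≼y
        stepToGens (inj₂ m)                   = message m ◅ ε

      isCMSC : E →
        (∀ e f → e ⊲ f → ∃₂ λ p q → Σ (p ≢ q) λ d → lab e ≡ send p q d × lab f ≡ recv q p d) →
        (∀ e f e′ f′ → e ⊲ f → e′ ⊲ f′ → SameProc e e′ → SameProc f f′ →
           (rank e ≤ rank e′) ⇔ (rank f ≤ rank f′)) →
        (∀ e → (∃ λ m → μ e ≡ just m) ⇔ Unm′ e) →
        (∀ e f g → e ⊲ f → Unm′ g →
           (lab g ≡ lab e → rank e < rank g) × (lab g ≡ lab f → rank g < rank f)) →
        IsCMSC E lab _≼_ _⊲_ μ
      isCMSC e₀ labels fifo dom-μ unm-order = record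
        { nonempty     = e₀
        ; countable    = inj₁ (N , enum)
        ; partialOrder = record
            { isPreorder = record
                { isEquivalence = isEquivalence
                ; reflexive     = λ { refl → star⇒≼ ε }
                ; trans         = λ x≼y y≼z → star⇒≼ (≼⇒star x≼y ◅◅ ≼⇒star y≼z) }
            ; antisym = λ x≼y y≼x → antisym (star-rank (≼⇒star x≼y)) (star-rank (≼⇒star y≼x)) }
        ; totalₚ       = total
        ; shapeₚ       = λ p → inj₁ (shape p)
        ; ⊲⊆≤          = λ _ _ m → star⇒≼ (message m ◅ ε)
        ; ⊲-labels     = labels
        ; fifo         = λ e f e′ f′ m m′ soe sof →
            ⇔-trans (≼⇔rank≤ soe) (⇔-trans (fifo e f e′ f′ m m′ soe sof) (⇔-sym (≼⇔rank≤ sof)))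
        ; ≤-closure    = λ _ _ → ≼⇔steps
        ; dom-μ        = dom-μ
        ; unm-order    = λ e f g m u →
            (λ eq → rank<⇒<E (cong owner (sym eq)) (proj₁ (unm-order e f g m u) eq)) ,
            (λ eq → rank<⇒<E (cong owner eq) (proj₂ (unm-order e f g m u) eq))
        }
        where
        antisym : ∀ {x y} → x ≡ y ⊎ rank x < rank y → y ≡ x ⊎ rank y < rank x → x ≡ y
        antisym (inj₁ eq) _         = eq
        antisym (inj₂ _)  (inj₁ eq) = sym eq
        antisym (inj₂ lt) (inj₂ gt) = ⊥-elim (<-asym lt gt)
        total : ∀ e f → SameProc e f → e ≼ f ⊎ f ≼ e
        total e f so with ≤-total (rank e) (rank f)
        ... | inj₁ le = inj₁ (Equivalence.from (≼⇔rank≤ so) le)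
        ... | inj₂ ge = inj₂ (Equivalence.from (≼⇔rank≤ (sym so)) ge)
        shape : ∀ p → ∃ λ n → Fin n ↔ Ev E lab _≼_ _⊲_ μ p
        shape p with decSubset↔Fin N (λ i → owner (lab (to i)) ≡ p) (λ i → owner (lab (to i)) Fin.≟ p)
                                   (Decidable⇒UIP.≡-irrelevant Fin._≟_)
        ... | n , e = n , ↔-trans e (Σ-↔ enum (↔-id _))

-- Counters as channels

Counter : Set
Counter = Fin 3

sender receiver : Counter → Fin 6
sender   c = combine {n = 2} c fzero
receiver c = combine {n = 2} c (fsuc fzero)

sender≢receiver : ∀ c c′ → sender c ≢ receiver c′
sender≢receiver c c′ eq with combine-injectiveʳ {n = 2} c fzero c′ (fsuc fzero) eq
... | ()

sender-injective : ∀ {c c′} → sender c ≡ sender c′ → c ≡ c′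
sender-injective = combine-injectiveˡ {n = 2} _ fzero _ fzero

receiver-injective : ∀ {c c′} → receiver c ≡ receiver c′ → c ≡ c′
receiver-injective = combine-injectiveˡ {n = 2} _ (fsuc fzero) _ (fsuc fzero)

data Kind : Set where
  snd rcv : Counter → Kind

kindAct : Kind → Act 6
kindAct (snd c) = send (sender c) (receiver c) (sender≢receiver c c)
kindAct (rcv c) = recv (receiver c) (sender c) (sender≢receiver c c)

kindAct-injective : ∀ {k k′} → kindAct k ≡ kindAct k′ → k ≡ k′
kindAct-injective {snd c} {snd c′} eq = cong snd (sender-injective (cong owner eq))
kindAct-injective {rcv c} {rcv c′} eq = cong rcv (receiver-injective (cong owner eq))
kindAct-injective {snd _} {rcv _} ()
kindAct-injective {rcv _} {snd _} ()

_≟ₖ_ : DecidableEquality Kind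
snd c ≟ₖ snd c′ = Dec.map′ (cong snd) (λ { refl → refl }) (c Fin.≟ c′)
rcv c ≟ₖ rcv c′ = Dec.map′ (cong rcv) (λ { refl → refl }) (c Fin.≟ c′)
snd _ ≟ₖ rcv _  = no λ ()
rcv _ ≟ₖ snd _  = no λ ()

data Op : Set where
  inc dec zero? : Counter → Op

blockKinds : Op → List Kind
blockKinds (inc c)   = snd c ∷ []
blockKinds (dec c)   = rcv c ∷ []
blockKinds (zero? c) = snd c ∷ rcv c ∷ []

blockSize : Op → ℕ
blockSize o = length (blockKinds o)

kindOf : (o : Op) → Fin (blockSize o) → Kind
kindOf o = lookup (blockKinds o)

blockLab : (o : Op) → Fin (blockSize o) → Act 6
blockLab o = kindAct ∘ kindOf o

blockLe : ∀ {n} → Fin n → Fin n → Bool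
blockLe a b = toℕ a ≤ᵇ toℕ b

blockMsg : (o : Op) → Fin (blockSize o) → Fin (blockSize o) → Bool
blockMsg (zero? c) fzero (fsuc fzero) = true
blockMsg _         _     _            = false

blockμ : (o : Op) → Fin (blockSize o) → Maybe ⊤
blockμ (zero? c) _ = nothing
blockμ _         _ = just tt

blockMsg-increasing : ∀ o {a b} → T (blockMsg o a b) → toℕ a < toℕ b
blockMsg-increasing (zero? c) {fzero} {fsuc fzero} _ = s≤s z≤n

module BlockCMSC (o : Op) where
  open Linearisation (↔-id (Fin (blockSize o))) (blockLab o) (λ a b → T (blockMsg o a b)) public
  open Ordered (blockMsg-increasing o) public

  blockLe⇔star : ∀ {a b} → T (blockLe a b) ⇔ Star Gen a b
  blockLe⇔star {a} {b} = mk⇔ (rank≤⇒gens o a b ∘ ≤ᵇ⇒≤ _ _) (≤⇒≤ᵇ ∘ star⇒rank≤)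
    where
    rank≤⇒gens : ∀ o (a b : Fin (blockSize o)) → toℕ a ≤ toℕ b →
                 Star (Linearisation.Gen (↔-id _) (blockLab o) (λ a b → T (blockMsg o a b))) a b
    rank≤⇒gens (inc c)   fzero        fzero        _ = ε
    rank≤⇒gens (dec c)   fzero        fzero        _ = ε
    rank≤⇒gens (zero? c) fzero        fzero        _ = ε
    rank≤⇒gens (zero? c) fzero        (fsuc fzero) _ = Linearisation.message tt ◅ ε
    rank≤⇒gens (zero? c) (fsuc fzero) (fsuc fzero) _ = ε

  open Closure (λ a b → T (blockLe a b)) blockLe⇔star (blockμ o) public

validBlock : ∀ o → IsCMSC (Fin (blockSize o)) (blockLab o) (λ a b → T (blockLe a b))
                          (λ a b → T (blockMsg o a b)) (blockμ o)
validBlock (inc c)   = BlockCMSC.isCMSC (inc c) fzero (λ _ _ ()) (λ _ _ _ _ ())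
                         (λ _ → mk⇔ (λ _ → λ { (_ , inj₁ ()) ; (_ , inj₂ ()) }) (λ _ → tt , refl))
                         (λ _ _ _ ())
validBlock (dec c)   = BlockCMSC.isCMSC (dec c) fzero (λ _ _ ()) (λ _ _ _ _ ())
                         (λ _ → mk⇔ (λ _ → λ { (_ , inj₁ ()) ; (_ , inj₂ ()) }) (λ _ → tt , refl))
                         (λ _ _ _ ())
validBlock (zero? c) = isCMSC fzero labels fifo (λ a → mk⇔ (λ ()) (⊥-elim ∘ matched a))
                         (λ _ _ g _ u → ⊥-elim (matched g u))
  where
  open BlockCMSC (zero? c)
  labels : ∀ (e f : Fin 2) → T (blockMsg (zero? c) e f) → ∃₂ λ p q → Σ (p ≢ q) λ d →
             blockLab (zero? c) e ≡ send p q d × blockLab (zero? c) f ≡ recv q p d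
  labels fzero (fsuc fzero) _ = sender c , receiver c , sender≢receiver c c , refl , refl
  fifo : ∀ (e f e′ f′ : Fin 2) → T (blockMsg (zero? c) e f) → T (blockMsg (zero? c) e′ f′) →
         SameProc e e′ → SameProc f f′ → (toℕ e ≤ toℕ e′) ⇔ (toℕ f ≤ toℕ f′)
  fifo fzero (fsuc fzero) fzero (fsuc fzero) _ _ _ _ = mk⇔ (λ _ → ≤-refl) (λ _ → ≤-refl)
  matched : ∀ a → ¬ Unm′ a
  matched fzero        u = u (fsuc fzero , inj₁ tt)
  matched (fsuc fzero) u = u (fzero , inj₂ tt)

block : Op → FCMSC 6 ⊤
block o = record { n = blockSize o ; lab = blockLab o ; le = blockLe ; msg = blockMsg o
                 ; μ = blockμ o ; valid = validBlock o }

-- Positions and occurrence counts in words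

at : ∀ {A : Set} → List A → ℕ → Maybe A
at []       _       = nothing
at (x ∷ _)  zero    = just x
at (_ ∷ xs) (suc g) = at xs g

at⇒< : ∀ {A : Set} (xs : List A) {g x} → at xs g ≡ just x → g < length xs
at⇒< (_ ∷ _)  {zero}  _  = s≤s z≤n
at⇒< (_ ∷ xs) {suc g} eq = s≤s (at⇒< xs eq)

at-++ʳ : ∀ {A : Set} (xs ys : List A) g → at (xs ++ ys) (length xs + g) ≡ at ys g
at-++ʳ []       ys g = refl
at-++ʳ (_ ∷ xs) ys g = at-++ʳ xs ys g

at-lookup : ∀ {A : Set} (xs ys : List A) i → at (xs ++ ys) (toℕ i) ≡ just (lookup xs i)
at-lookup (_ ∷ _)  ys fzero    = refl
at-lookup (_ ∷ xs) ys (fsuc i) = at-lookup xs ys i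

hit : Kind → Kind → ℕ
hit k x = if does (x ≟ₖ k) then 1 else 0

hit-self : ∀ k → hit k k ≡ 1
hit-self k = cong (if_then 1 else 0) (dec-true (k ≟ₖ k) refl)

hit-other : ∀ {k x} → x ≢ k → hit k x ≡ 0
hit-other {k} {x} x≢k = cong (if_then 1 else 0) (dec-false (x ≟ₖ k) x≢k)

-- occurrences of k among the first g letters
occ : Kind → List Kind → ℕ → ℕ
occ k []       _       = 0
occ k (_ ∷ _)  zero    = 0
occ k (x ∷ xs) (suc g) = hit k x + occ k xs g

total : Kind → List Kind → ℕ
total k xs = occ k xs (length xs)

module _ (k : Kind) where

  occ-zero : ∀ xs → occ k xs 0 ≡ 0
  occ-zero []      = refl
  occ-zero (_ ∷ _) = refl

  occ-++ʳ : ∀ xs ys g → occ k (xs ++ ys) (length xs + g) ≡ total k xs + occ k ys g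
  occ-++ʳ []       ys g = refl
  occ-++ʳ (x ∷ xs) ys g = trans (cong (hit k x +_) (occ-++ʳ xs ys g)) (sym (+-assoc (hit k x) _ _))

  occ-++ˡ : ∀ xs ys {g} → g ≤ length xs → occ k (xs ++ ys) g ≡ occ k xs g
  occ-++ˡ []       ys z≤n     = occ-zero ys
  occ-++ˡ (_ ∷ _)  ys z≤n     = refl
  occ-++ˡ (x ∷ xs) ys (s≤s g≤) = cong (hit k x +_) (occ-++ˡ xs ys g≤)

  total-++ : ∀ xs ys → total k (xs ++ ys) ≡ total k xs + total k ys
  total-++ xs ys = trans (cong (occ k (xs ++ ys)) (length-++ xs)) (occ-++ʳ xs ys (length ys))

  occ-suc : ∀ xs {g x} → at xs g ≡ just x → occ k xs (suc g) ≡ hit k x + occ k xs g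
  occ-suc (x ∷ xs) {zero}  refl = cong (hit k x +_) (occ-zero xs)
  occ-suc (y ∷ xs) {suc g} {x} eq =
    trans (cong (hit k y +_) (occ-suc xs eq)) (x∙yz≈y∙xz (hit k y) (hit k x) (occ k xs g))

  occ-suc-self : ∀ xs {g} → at xs g ≡ just k → occ k xs (suc g) ≡ suc (occ k xs g)
  occ-suc-self xs {g} eq = trans (occ-suc xs eq) (cong (_+ occ k xs g) (hit-self k))

  occ-suc-other : ∀ xs {g x} → at xs g ≡ just x → x ≢ k → occ k xs (suc g) ≡ occ k xs g
  occ-suc-other xs {g} eq x≢k = trans (occ-suc xs eq) (cong (_+ occ k xs g) (hit-other x≢k))

  occ-mono : ∀ xs {g g′} → g ≤ g′ → occ k xs g ≤ occ k xs g′
  occ-mono []       _         = z≤n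
  occ-mono (_ ∷ _)  z≤n       = z≤n
  occ-mono (x ∷ xs) (s≤s g≤g′) = +-monoʳ-≤ (hit k x) (occ-mono xs g≤g′)

  occ-strict : ∀ xs {g g′} → at xs g ≡ just k → g < g′ → occ k xs g < occ k xs g′
  occ-strict xs at-g g<g′ = ≤-trans (≤-reflexive (sym (occ-suc-self xs at-g))) (occ-mono xs g<g′)

  occ-index : ∀ xs g {j} → j < occ k xs g →
              ∃ λ g₀ → g₀ < g × at xs g₀ ≡ just k × occ k xs g₀ ≡ j
  occ-index (x ∷ xs) (suc g) {j} j< with x ≟ₖ k
  occ-index (x ∷ xs) (suc g) {zero}  _        | yes refl = 0 , s≤s z≤n , refl , refl
  occ-index (x ∷ xs) (suc g) {suc j} (s≤s j<) | yes refl with occ-index xs g j<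
  ... | g₀ , g₀<g , at-g₀ , occ-g₀ =
    suc g₀ , s≤s g₀<g , at-g₀ , trans (cong (_+ occ x xs g₀) (hit-self x)) (cong suc occ-g₀)
  occ-index (x ∷ xs) (suc g) {j} j< | no x≢k with occ-index xs g j<
  ... | g₀ , g₀<g , at-g₀ , occ-g₀ =
    suc g₀ , s≤s g₀<g , at-g₀ , trans (cong (_+ occ k xs g₀) (hit-other x≢k)) occ-g₀

  occ-mono⇔ : ∀ xs {g g′} → at xs g′ ≡ just k → (g ≤ g′) ⇔ (occ k xs g ≤ occ k xs g′)
  occ-mono⇔ xs {g} {g′} at-g′ = mk⇔ (occ-mono xs) reflect
    where
    reflect : occ k xs g ≤ occ k xs g′ → g ≤ g′
    reflect occ≤ with ≤-<-connex g g′
    ... | inj₁ g≤g′ = g≤g′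
    ... | inj₂ g′<g = ⊥-elim (<⇒≱ (occ-strict xs at-g′ g′<g) occ≤)

  occ-injective : ∀ xs {g g′} → at xs g ≡ just k → at xs g′ ≡ just k →
                  occ k xs g ≡ occ k xs g′ → g ≡ g′
  occ-injective xs at-g at-g′ eq =
    ≤-antisym (Equivalence.from (occ-mono⇔ xs at-g′) (≤-reflexive eq))
              (Equivalence.from (occ-mono⇔ xs at-g) (≤-reflexive (sym eq)))

-- Events of a concatenation of blocks

kindsOf : List Op → List Kind
kindsOf []       = []
kindsOf (o ∷ os) = blockKinds o ++ kindsOf os

kindsOf-++ : ∀ os os′ → kindsOf (os ++ os′) ≡ kindsOf os ++ kindsOf os′
kindsOf-++ []       os′ = refl
kindsOf-++ (o ∷ os) os′ = trans (cong (blockKinds o ++_) (kindsOf-++ os os′))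
                                (sym (++-assoc (blockKinds o) (kindsOf os) (kindsOf os′)))

Events : Op → List Op → Set
Events o os = EvList (block o) (map block os)

size : Op → List Op → ℕ
size o []        = blockSize o
size o (o′ ∷ os) = blockSize o + size o′ os

size≡length : ∀ o os → size o os ≡ length (kindsOf (o ∷ os))
size≡length o []        = sym (trans (length-++ (blockKinds o)) (+-identityʳ _))
size≡length o (o′ ∷ os) = trans (cong (blockSize o +_) (size≡length o′ os)) (sym (length-++ (blockKinds o)))

pos : ∀ o os → Events o os → ℕ
pos o []        a        = toℕ a
pos o (o′ ∷ os) (inj₁ a) = toℕ a
pos o (o′ ∷ os) (inj₂ y) = blockSize o + pos o′ os y

kind : ∀ o os → Events o os → Kind
kind o []        a        = kindOf o a
kind o (o′ ∷ os) (inj₁ a) = kindOf o a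
kind o (o′ ∷ os) (inj₂ y) = kind o′ os y

at-pos : ∀ o os x → at (kindsOf (o ∷ os)) (pos o os x) ≡ just (kind o os x)
at-pos o []        a        = at-lookup (blockKinds o) [] a
at-pos o (o′ ∷ os) (inj₁ a) = at-lookup (blockKinds o) _ a
at-pos o (o′ ∷ os) (inj₂ y) = trans (at-++ʳ (blockKinds o) _ (pos o′ os y)) (at-pos o′ os y)

enumeration : ∀ o os → Fin (size o os) ↔ Events o os
enumeration o []        = ↔-id _
enumeration o (o′ ∷ os) = ↔-trans +↔⊎ (↔-id _ ⊎-↔ enumeration o′ os)

rank≡pos : ∀ o os x → toℕ (Inverse.from (enumeration o os) x) ≡ pos o os x
rank≡pos o []        a        = refl
rank≡pos o (o′ ∷ os) (inj₁ a) = toℕ-↑ˡ a (size o′ os)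
rank≡pos o (o′ ∷ os) (inj₂ y) = trans (toℕ-↑ʳ (blockSize o) _) (cong (blockSize o +_) (rank≡pos o′ os y))

pos<size : ∀ o os x → pos o os x < size o os
pos<size o os x = subst (_< size o os) (rank≡pos o os x) (toℕ<n _)

event-at : ∀ o os {p} → p < size o os → ∃ λ z → pos o os z ≡ p
event-at o os p<size = to (fromℕ< p<size) ,
  trans (sym (rank≡pos o os _)) (trans (cong toℕ (strictlyInverseʳ (fromℕ< p<size))) (toℕ-fromℕ< p<size))
  where open Inverse (enumeration o os)

firstEvent : ∀ o os → Events o os
firstEvent (inc _)   []       = fzero
firstEvent (dec _)   []       = fzero
firstEvent (zero? _) []       = fzero
firstEvent (inc _)   (_ ∷ _)  = inj₁ fzero
firstEvent (dec _)   (_ ∷ _)  = inj₁ fzero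
firstEvent (zero? _) (_ ∷ _)  = inj₁ fzero

-- From counter runs to MSCs

record CounterConsistent (W : List Op) : Set where
  private word = kindsOf W
  field
    rcv-after-snd : ∀ g c → at word g ≡ just (rcv c) → occ (rcv c) word g < occ (snd c) word g
    balanced      : ∀ c → total (snd c) word ≡ total (rcv c) word
    empty-at-test : ∀ pre c post → pre ++ zero? c ∷ post ≡ W →
                    occ (snd c) word (length (kindsOf pre)) ≡ occ (rcv c) word (length (kindsOf pre))

at-functional : ∀ {A : Set} (xs : List A) {g x y} → at xs g ≡ just x → at xs g ≡ just y → x ≡ y
at-functional xs ax ay = just-injective (trans (sym ax) ay)

blockMsg-complete : ∀ o (a b : Fin (blockSize o)) → toℕ a < toℕ b → T (blockMsg o a b)
blockMsg-complete (inc c)   fzero        fzero        ()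
blockMsg-complete (dec c)   fzero        fzero        ()
blockMsg-complete (zero? c) fzero        fzero        ()
blockMsg-complete (zero? c) fzero        (fsuc fzero) _ = tt
blockMsg-complete (zero? c) (fsuc fzero) (fsuc fzero) (s≤s ())

blockMsg-zeroTest : ∀ o a b → T (blockMsg o a b) →
                    ∃ λ c → o ≡ zero? c × kindOf o a ≡ snd c × kindOf o b ≡ rcv c × toℕ a ≡ 0 × toℕ b ≡ 1
blockMsg-zeroTest (zero? c) fzero (fsuc fzero) _ = c , refl , refl , refl , refl , refl

blockμ-unmatched : ∀ o a → ¬ (∃ λ b → T (blockMsg o a b) ⊎ T (blockMsg o b a)) → blockμ o a ≡ just tt
blockμ-unmatched (inc c)   a            _ = refl
blockμ-unmatched (dec c)   a            _ = refl
blockμ-unmatched (zero? c) fzero        u = ⊥-elim (u (fsuc fzero , inj₁ tt))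
blockμ-unmatched (zero? c) (fsuc fzero) u = ⊥-elim (u (fzero , inj₂ tt))

module Forward (W : List Op) (consistent : CounterConsistent W) where
  open CounterConsistent consistent

  word : List Kind
  word = kindsOf W

  -- FIFO forces the i-th send on a channel to be received by its i-th receive
  MatchesOn : Counter → ℕ → ℕ → Set
  MatchesOn c g₁ g₂ = at word g₁ ≡ just (snd c) × at word g₂ ≡ just (rcv c) × g₁ < g₂
                    × occ (snd c) word g₁ ≡ occ (rcv c) word g₂

  Matches : ℕ → ℕ → Set
  Matches g₁ g₂ = ∃ λ c → MatchesOn c g₁ g₂

  matches? : ∀ g₁ g₂ → Dec (Matches g₁ g₂)
  matches? g₁ g₂ = any? λ c →
    ≡-decMaybe _≟ₖ_ (at word g₁) (just (snd c)) ×-dec ≡-decMaybe _≟ₖ_ (at word g₂) (just (rcv c))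
      ×-dec g₁ <? g₂ ×-dec occ (snd c) word g₁ ≟ occ (rcv c) word g₂

  matches-< : ∀ {g₁ g₂} → Matches g₁ g₂ → g₁ < g₂
  matches-< (_ , _ , _ , lt , _) = lt

  matches-injectiveˡ : ∀ {g₁ g₁′ g₂} → Matches g₁ g₂ → Matches g₁′ g₂ → g₁ ≡ g₁′
  matches-injectiveˡ (c , a₁ , a₂ , _ , eq) (c′ , a₁′ , a₂′ , _ , eq′) with at-functional word a₂ a₂′
  ... | refl = occ-injective (snd c) word a₁ a₁′ (trans eq (sym eq′))

  matches-injectiveʳ : ∀ {g₁ g₂ g₂′} → Matches g₁ g₂ → Matches g₁ g₂′ → g₂ ≡ g₂′
  matches-injectiveʳ (c , a₁ , a₂ , _ , eq) (c′ , a₁′ , a₂′ , _ , eq′) with at-functional word a₁ a₁′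
  ... | refl = occ-injective (rcv c) word a₂ a₂′ (trans (sym eq) eq′)

  matches-disjoint : ∀ {g g₀ g₂} → Matches g g₂ → Matches g₀ g → ⊥
  matches-disjoint (_ , at-snd , _) (_ , _ , at-rcv , _) = case at-functional word at-snd at-rcv of λ ()

  rcv-partner : ∀ g c → at word g ≡ just (rcv c) → ∃ λ g₀ → MatchesOn c g₀ g
  rcv-partner g c at-g with occ-index (snd c) word g (rcv-after-snd g c at-g)
  ... | g₀ , g₀<g , at-g₀ , occ-g₀ = g₀ , at-g₀ , at-g , g₀<g , occ-g₀

  snd-partner : ∀ g c → at word g ≡ just (snd c) → ∃ λ g₂ → MatchesOn c g g₂
  snd-partner g c at-g with occ-index (rcv c) word (length word) sent<received
    where
    sent<received : occ (snd c) word g < total (rcv c) word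
    sent<received = subst (occ (snd c) word g <_) (balanced c) (occ-strict (snd c) word at-g (at⇒< word at-g))
  ... | g₂ , _ , at-g₂ , occ-g₂ = g₂ , at-g , at-g₂ , g<g₂ , sym occ-g₂
    where
    g<g₂ : g < g₂
    g<g₂ with <-cmp g g₂
    ... | tri< lt _ _   = lt
    ... | tri≈ _ refl _ = case at-functional word at-g at-g₂ of λ ()
    ... | tri> _ _ g₂<g = ⊥-elim (<⇒≱ (rcv-after-snd g₂ c at-g₂)
                                   (≤-trans (occ-mono (snd c) word (<⇒≤ g₂<g)) (≤-reflexive (sym occ-g₂))))

  -- the shape of the cMSCs built for the suffixes of W; a suffix starts at position off of the word
  record Canonical (off : ℕ) (o : Op) (os : List Op) (Y : CMSC 6 ⊤ (Events o os)) : Set where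
    open CMSC Y renaming (_≤_ to _≤Y_)
    field
      lab≡kind   : ∀ y → lab y ≡ kindAct (kind o os y)
      ≤⇔pos≤     : ∀ y y′ → owner (lab y) ≡ owner (lab y′) → (y ≤Y y′) ⇔ (pos o os y ≤ pos o os y′)
      ⊲⇔matches  : ∀ y y′ → (y ⊲ y′) ⇔ Matches (off + pos o os y) (off + pos o os y′)
      unmatched-μ : ∀ y → Unm (Events o os) lab _≤Y_ _⊲_ μ y → μ y ≡ just tt

  module Suffix (pre : List Op) (o : Op) (os : List Op) (eq : pre ++ o ∷ os ≡ W) where

    off : ℕ
    off = length (kindsOf pre)

    gpos : Events o os → ℕ
    gpos x = off + pos o os x

    word≡ : word ≡ kindsOf pre ++ kindsOf (o ∷ os)
    word≡ = trans (cong kindsOf (sym eq)) (kindsOf-++ pre (o ∷ os))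

    length-word : off + size o os ≡ length word
    length-word = trans (cong (off +_) (size≡length o os))
                     (trans (sym (length-++ (kindsOf pre))) (cong length (sym word≡)))

    at-shift : ∀ n → at word (off + n) ≡ at (kindsOf (o ∷ os)) n
    at-shift n = trans (cong (λ l → at l (off + n)) word≡) (at-++ʳ (kindsOf pre) _ n)

    at-gpos : ∀ x → at word (gpos x) ≡ just (kind o os x)
    at-gpos x = trans (at-shift (pos o os x)) (at-pos o os x)

    at-block : ∀ a → at word (off + toℕ a) ≡ just (kindOf o a)
    at-block a = trans (at-shift (toℕ a)) (at-lookup (blockKinds o) _ a)

    gpos<length : ∀ x → gpos x < length word
    gpos<length x = subst (gpos x <_) length-word (+-monoʳ-< off (pos<size o os x))

    event-at-global : ∀ p → off ≤ p → p < length word → ∃ λ z → gpos z ≡ p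
    event-at-global p off≤p p<L
      with event-at o os (+-cancelˡ-< off _ _ (subst₂ _<_ (sym (m+[n∸m]≡n off≤p)) (sym length-word) p<L))
    ... | z , pos-z = z , trans (cong (off +_) pos-z) (m+[n∸m]≡n off≤p)

    -- the message of a zero test is matched because the channel is empty there
    blockMatches : ∀ a b → T (blockMsg o a b) → Matches (off + toℕ a) (off + toℕ b)
    blockMatches a b m with blockMsg-zeroTest o a b m
    ... | c , refl , ka , kb , a≡0 , b≡1 =
      c , trans (at-block a) (cong just ka) , trans (at-block b) (cong just kb) ,
      +-monoʳ-< off (subst₂ _<_ (sym a≡0) (sym b≡1) (s≤s z≤n)) , balance
      where
      off+a≡off : off + toℕ a ≡ off
      off+a≡off = trans (cong (off +_) a≡0) (+-identityʳ off)
      off+b≡1+off : off + toℕ b ≡ suc off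
      off+b≡1+off = trans (cong (off +_) b≡1) (+-comm off 1)
      at-off : at word off ≡ just (snd c)
      at-off = trans (cong (at word) (sym off+a≡off)) (trans (at-block a) (cong just ka))
      balance : occ (snd c) word (off + toℕ a) ≡ occ (rcv c) word (off + toℕ b)
      balance = begin
        occ (snd c) word (off + toℕ a) ≡⟨ cong (occ (snd c) word) off+a≡off ⟩
        occ (snd c) word off           ≡⟨ empty-at-test pre c os eq ⟩
        occ (rcv c) word off           ≡⟨ occ-suc-other (rcv c) word at-off (λ ()) ⟨
        occ (rcv c) word (suc off)     ≡⟨ cong (occ (rcv c) word) off+b≡1+off ⟨
        occ (rcv c) word (off + toℕ b) ∎
        where open ≡-Reasoning

    _⊲_ : Events o os → Events o os → Set
    x ⊲ y = Matches (gpos x) (gpos y)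

    open Linearisation (enumeration o os) (kindAct ∘ kind o os) _⊲_ public

    rank≤⇔gpos≤ : ∀ x y → (rank x ≤ rank y) ⇔ (gpos x ≤ gpos y)
    rank≤⇔gpos≤ x y = mk⇔ (+-monoʳ-≤ off ∘ subst₂ _≤_ (rank≡pos o os x) (rank≡pos o os y))
                          (subst₂ _≤_ (sym (rank≡pos o os x)) (sym (rank≡pos o os y)) ∘ +-cancelˡ-≤ off _ _)

    gpos<⇒rank< : ∀ {x y} → gpos x < gpos y → rank x < rank y
    gpos<⇒rank< {x} {y} lt =
      subst₂ _<_ (sym (rank≡pos o os x)) (sym (rank≡pos o os y)) (+-cancelˡ-< off _ _ lt)

    open Ordered (gpos<⇒rank< ∘ matches-<) public

    matched? : ∀ x → Dec (∃ λ z → x ⊲ z ⊎ z ⊲ x)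
    matched? x = Dec.map′ (λ (i , m) → Inverse.to (enumeration o os) i , m)
                          (λ (z , m) → Inverse.from (enumeration o os) z ,
                                       subst (λ w → x ⊲ w ⊎ w ⊲ x)
                                             (sym (Inverse.strictlyInverseˡ (enumeration o os) z)) m)
                          (any? λ i → matches? (gpos x) (gpos (Inverse.to (enumeration o os) i))
                                       ⊎-dec matches? (gpos (Inverse.to (enumeration o os) i)) (gpos x))

    μ : Events o os → Maybe ⊤
    μ x with matched? x
    ... | yes _ = nothing
    ... | no  _ = just tt

    open Closure (Star Gen) (⇔-id _) μ public

    dom-μ : ∀ e → (∃ λ m → μ e ≡ just m) ⇔ Unm′ e
    dom-μ e with matched? e
    ... | yes m = mk⇔ (λ ()) (λ u → ⊥-elim (u m))
    ... | no ¬m = mk⇔ (λ _ → ¬m) (λ _ → tt , refl)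

    unmatched-μ : ∀ e → Unm′ e → μ e ≡ just tt
    unmatched-μ e u with matched? e
    ... | yes m = ⊥-elim (u m)
    ... | no  _ = refl

    kind-snd : ∀ x {c} → at word (gpos x) ≡ just (snd c) → kind o os x ≡ snd c
    kind-snd x = at-functional word (at-gpos x)

    kind-rcv : ∀ x {c} → at word (gpos x) ≡ just (rcv c) → kind o os x ≡ rcv c
    kind-rcv x = at-functional word (at-gpos x)

    labels : ∀ e f → e ⊲ f → ∃₂ λ p q → Σ (p ≢ q) λ d →
             kindAct (kind o os e) ≡ send p q d × kindAct (kind o os f) ≡ recv q p d
    labels e f (c , at-e , at-f , _) =
      sender c , receiver c , sender≢receiver c c , cong kindAct (kind-snd e at-e) , cong kindAct (kind-rcv f at-f)

    fifo : ∀ e f e′ f′ → e ⊲ f → e′ ⊲ f′ → SameProc e e′ → SameProc f f′ →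
           (rank e ≤ rank e′) ⇔ (rank f ≤ rank f′)
    fifo e f e′ f′ (c , a , b , _ , m) (c′ , a′ , b′ , _ , m′) e~e′ _
      with sender-injective {c} {c′} (subst₂ (λ k k′ → owner (kindAct k) ≡ owner (kindAct k′))
                                    (kind-snd e a) (kind-snd e′ a′) e~e′)
    ... | refl =
      ⇔-trans (rank≤⇔gpos≤ e e′) (⇔-trans (occ-mono⇔ (snd c) word a′)
        (⇔-trans (subst₂ (λ u v → (u ≤ v) ⇔ (occ (rcv c) word (gpos f) ≤ occ (rcv c) word (gpos f′)))
                         (sym m) (sym m′) (⇔-id _))
          (⇔-sym (⇔-trans (rank≤⇔gpos≤ f f′) (occ-mono⇔ (rcv c) word b′)))))

    -- a send of the suffix is always matched inside it; an unmatched receive is matched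
    -- before the suffix, hence precedes every matched receive of its channel
    unm-order : ∀ e f g → e ⊲ f → Unm′ g →
                (kindAct (kind o os g) ≡ kindAct (kind o os e) → rank e < rank g)
              × (kindAct (kind o os g) ≡ kindAct (kind o os f) → rank g < rank f)
    unm-order e f g (c , at-e , at-f , _ , occ-ef) u = sndMatched , rcvEarlier
      where
      at-g : ∀ {x k} → kindAct (kind o os g) ≡ kindAct (kind o os x) → kind o os x ≡ k → at word (gpos g) ≡ just k
      at-g eqk kx = trans (at-gpos g) (cong just (trans (kindAct-injective eqk) kx))
      sndMatched : kindAct (kind o os g) ≡ kindAct (kind o os e) → rank e < rank g
      sndMatched eqk with snd-partner (gpos g) c (at-g eqk (kind-snd e at-e))
      ... | g₂ , m₂@(_ , at-g₂ , g<g₂ , _) with event-at-global g₂ (≤-trans (m≤m+n off _) (<⇒≤ g<g₂)) (at⇒< word at-g₂)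
      ...   | z , refl = ⊥-elim (u (z , inj₁ (c , m₂)))
      rcvEarlier : kindAct (kind o os g) ≡ kindAct (kind o os f) → rank g < rank f
      rcvEarlier eqk with rcv-partner (gpos g) c (at-g eqk (kind-rcv f at-f))
      ... | g₀ , m₀@(at-g₀ , _ , g₀<g , occ-g₀) with off ≤? g₀
      ...   | yes off≤g₀ with event-at-global g₀ off≤g₀ (<-trans g₀<g (gpos<length g))
      ...     | z , refl = ⊥-elim (u (z , inj₂ (c , m₀)))
      rcvEarlier eqk | g₀ , (at-g₀ , _ , g₀<g , occ-g₀) | no off≰g₀ =
        gpos<⇒rank< (≰⇒> λ gf≤gg → <⇒≱ fewer (occ-mono (rcv c) word gf≤gg))
        where
        fewer : occ (rcv c) word (gpos g) < occ (rcv c) word (gpos f)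
        fewer = subst₂ _<_ occ-g₀ occ-ef
                  (occ-strict (snd c) word at-g₀ (<-≤-trans (≰⇒> off≰g₀) (m≤m+n off _)))

    suffixCMSC : CMSC 6 ⊤ (Events o os)
    suffixCMSC = record
      { lab = kindAct ∘ kind o os ; _≤_ = Star Gen ; _⊲_ = _⊲_ ; μ = μ
      ; isCMSC = isCMSC (firstEvent o os) labels fifo dom-μ unm-order }

    canonical : Canonical off o os suffixCMSC
    canonical = record
      { lab≡kind    = λ _ → refl
      ; ≤⇔pos≤      = λ y y′ so → ⇔-trans (≼⇔rank≤ so)
                        (mk⇔ (subst₂ _≤_ (rank≡pos o os y) (rank≡pos o os y′))
                             (subst₂ _≤_ (sym (rank≡pos o os y)) (sym (rank≡pos o os y′))))
      ; ⊲⇔matches   = λ _ _ → ⇔-id _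
      ; unmatched-μ = unmatched-μ }

  canonicalLast : ∀ pre o → pre ++ o ∷ [] ≡ W → Canonical (length (kindsOf pre)) o [] (toCMSC (block o))
  canonicalLast pre o eq = record
    { lab≡kind    = λ _ → refl
    ; ≤⇔pos≤      = λ _ _ _ → mk⇔ (≤ᵇ⇒≤ _ _) ≤⇒≤ᵇ
    ; ⊲⇔matches   = λ a b → mk⇔ (blockMatches a b)
                                 (blockMsg-complete o a b ∘ +-cancelˡ-< off _ _ ∘ matches-<)
    ; unmatched-μ = blockμ-unmatched o }
    where open Suffix pre o [] eq using (off; blockMatches)

  module Cons (pre : List Op) (o o′ : Op) (os : List Op) (eq : pre ++ o ∷ o′ ∷ os ≡ W)
              (Y : CMSC 6 ⊤ (Events o′ os)) (canonicalY : Canonical (length (kindsOf (pre ++ o ∷ []))) o′ os Y) where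
    open Suffix pre o (o′ ∷ os) eq
    private
      module Y  = CMSC Y
      module CY = Canonical canonicalY

    shift : ∀ n → length (kindsOf (pre ++ o ∷ [])) + n ≡ off + (blockSize o + n)
    shift n = begin
      length (kindsOf (pre ++ o ∷ [])) + n        ≡⟨ cong (λ l → length l + n) (kindsOf-++ pre (o ∷ [])) ⟩
      length (kindsOf pre ++ kindsOf (o ∷ [])) + n ≡⟨ cong (_+ n) (length-++ (kindsOf pre)) ⟩
      off + length (blockKinds o ++ []) + n
        ≡⟨ cong (λ m → off + m + n) (trans (length-++ (blockKinds o)) (+-identityʳ _)) ⟩
      off + blockSize o + n                        ≡⟨ +-assoc off (blockSize o) n ⟩
      off + (blockSize o + n)                      ∎
      where open ≡-Reasoning

    matchesY⇔ : ∀ y y′ → (y Y.⊲ y′) ⇔ (inj₂ y ⊲ inj₂ y′)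
    matchesY⇔ y y′ = ⇔-trans (CY.⊲⇔matches y y′)
                             (mk⇔ (subst₂ Matches (shift _) (shift _))
                                  (subst₂ Matches (sym (shift _)) (sym (shift _))))

    block<rest : ∀ a n → off + toℕ a < off + (blockSize o + n)
    block<rest a n = +-monoʳ-< off (<-≤-trans (toℕ<n a) (m≤m+n (blockSize o) n))

    order : ∀ x y → SameProc x y → Star Gen x y ⇔ CatLe (block o) Y x y
    order (inj₁ a) (inj₁ b) so =
      ⇔-trans (≼⇔rank≤ so) (⇔-trans (rank≤⇔gpos≤ (inj₁ a) (inj₁ b))
                                    (mk⇔ (≤⇒≤ᵇ ∘ +-cancelˡ-≤ off _ _) (+-monoʳ-≤ off ∘ ≤ᵇ⇒≤ _ _)))
    order (inj₂ a) (inj₂ b) so =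
      ⇔-trans (≼⇔rank≤ so) (⇔-trans (rank≤⇔gpos≤ (inj₂ a) (inj₂ b))
        (⇔-trans (mk⇔ (+-cancelˡ-≤ (blockSize o) _ _ ∘ +-cancelˡ-≤ off _ _)
                      (+-monoʳ-≤ off ∘ +-monoʳ-≤ (blockSize o)))
                 (⇔-sym (CY.≤⇔pos≤ a b (subst₂ (λ u v → owner u ≡ owner v)
                                                (sym (CY.lab≡kind a)) (sym (CY.lab≡kind b)) so)))))
    order (inj₁ a) (inj₂ b) so =
      mk⇔ (λ _ → tt) (λ _ → Equivalence.from (≼⇔rank≤ so)
                               (Equivalence.from (rank≤⇔gpos≤ (inj₁ a) (inj₂ b)) (<⇒≤ (block<rest a _))))
    order (inj₂ a) (inj₁ b) so =
      mk⇔ (λ b≼a → <⇒≱ (block<rest b _) (Equivalence.to (rank≤⇔gpos≤ (inj₂ a) (inj₁ b))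
                                            (Equivalence.to (≼⇔rank≤ so) b≼a)))
          (λ ())

    crossing : ∀ {a y} → inj₁ a ⊲ inj₂ y → blockμ o a ≡ just tt × Y.μ y ≡ just tt
    crossing {a} {y} m = blockμ-unmatched o a aUnmatched , CY.unmatched-μ y yUnmatched
      where
      aUnmatched : ¬ (∃ λ a′ → T (blockMsg o a a′) ⊎ T (blockMsg o a′ a))
      aUnmatched (a′ , inj₁ p) = <-irrefl (sym (matches-injectiveʳ m (blockMatches a a′ p))) (block<rest a′ _)
      aUnmatched (a′ , inj₂ p) = matches-disjoint m (blockMatches a′ a p)
      yUnmatched : ¬ (∃ λ z → y Y.⊲ z ⊎ z Y.⊲ y)
      yUnmatched (z , inj₁ p) = matches-disjoint (Equivalence.to (matchesY⇔ y z) p) m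
      yUnmatched (z , inj₂ p) = <-irrefl (matches-injectiveˡ m (Equivalence.to (matchesY⇔ z y) p)) (block<rest a _)

    others : ∀ x y → x ⊲ y → CatMsg (block o) Y x y
    others (inj₁ a) (inj₁ b) m = blockMsg-complete o a b (+-cancelˡ-< off _ _ (matches-< m))
    others (inj₂ a) (inj₂ b) m = Equivalence.from (matchesY⇔ a b) m
    others (inj₂ a) (inj₁ b) m = <-asym (matches-< m) (block<rest b _)
    others (inj₁ a) (inj₂ b) m = tt , crossing m

    μ-inh : ∀ x → Unm′ x → μ x ≡ CatMu (block o) Y x
    μ-inh (inj₁ a) u = trans (unmatched-μ (inj₁ a) u) (sym (blockμ-unmatched o a λ
      { (a′ , inj₁ m) → u (inj₁ a′ , inj₁ (blockMatches a a′ m))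
      ; (a′ , inj₂ m) → u (inj₁ a′ , inj₂ (blockMatches a′ a m)) }))
    μ-inh (inj₂ y) u = trans (unmatched-μ (inj₂ y) u) (sym (CY.unmatched-μ y λ
      { (z , inj₁ m) → u (inj₂ z , inj₁ (Equivalence.to (matchesY⇔ y z) m))
      ; (z , inj₂ m) → u (inj₂ z , inj₂ (Equivalence.to (matchesY⇔ z y) m)) }))

    concat : Concat (block o) Y suffixCMSC
    concat = record
      { lab-inh = λ { (inj₁ a) → refl ; (inj₂ y) → sym (CY.lab≡kind y) }
      ; ≤ₚ      = order
      ; old₁    = blockMatches
      ; old₂    = λ y y′ → Equivalence.to (matchesY⇔ y y′)
      ; others  = others
      ; μ-inh   = μ-inh }

  realise : ∀ pre o os (eq : pre ++ o ∷ os ≡ W) →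
            Σ (CMSC 6 ⊤ (Events o os)) λ Y → InCat (block o) (map block os) Y × Canonical (length (kindsOf pre)) o os Y
  realise pre o []        eq = toCMSC (block o) , refl , canonicalLast pre o eq
  realise pre o (o′ ∷ os) eq with realise (pre ++ o ∷ []) o′ os (trans (++-assoc pre (o ∷ []) (o′ ∷ os)) eq)
  ... | Y , inCatY , canonicalY =
    Suffix.suffixCMSC pre o (o′ ∷ os) eq , (Y , inCatY , Cons.concat pre o o′ os eq Y canonicalY) ,
    Suffix.canonical pre o (o′ ∷ os) eq

  -- every send has a later partner and every receive an earlier one, so nothing is unmatched
  msc : ∀ o os → o ∷ os ≡ W → Σ (CMSC 6 ⊤ (Events o os)) λ X → InCat (block o) (map block os) X × IsMSC X
  msc o os eq with realise [] o os eq
  ... | X , inCatX , canonicalX = X , inCatX , noneUnmatched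
    where
    open Canonical canonicalX
    open Suffix [] o os eq using (at-gpos; event-at-global; gpos<length)
    noneUnmatched : IsMSC X
    noneUnmatched e u with kind o os e in kind-e
    ... | snd c with snd-partner (pos o os e) c (trans (at-gpos e) (cong just kind-e))
    ...   | g₂ , m with event-at-global g₂ z≤n (at⇒< word (proj₁ (proj₂ m)))
    ...     | z , refl = u (z , inj₁ (Equivalence.from (⊲⇔matches e z) (c , m)))
    noneUnmatched e u | rcv c with rcv-partner (pos o os e) c (trans (at-gpos e) (cong just kind-e))
    ...   | g₀ , m with event-at-global g₀ z≤n (<-trans (proj₁ (proj₂ (proj₂ m))) (gpos<length e))
    ...     | z , refl = u (z , inj₂ (Equivalence.from (⊲⇔matches z e) (c , m)))

-- From MSCs to counter runs

BlockMsg : ∀ o os → Events o os → Events o os → Set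
BlockMsg o []        a        b        = T (blockMsg o a b)
BlockMsg o (o′ ∷ os) (inj₁ a) (inj₁ b) = T (blockMsg o a b)
BlockMsg o (o′ ∷ os) (inj₂ a) (inj₂ b) = BlockMsg o′ os a b
BlockMsg o (o′ ∷ os) _        _        = ⊥

record Layout (o : Op) (os : List Op) (X : CMSC 6 ⊤ (Events o os)) : Set where
  open CMSC X renaming (_≤_ to _≼_)
  field
    lab≡kind   : ∀ x → lab x ≡ kindAct (kind o os x)
    ≼⇔pos≤     : ∀ x y → owner (lab x) ≡ owner (lab y) → (x ≼ y) ⇔ (pos o os x ≤ pos o os y)
    ⊲⇒pos<     : ∀ {x y} → x ⊲ y → pos o os x < pos o os y
    blockMsg⇒⊲ : ∀ {x y} → BlockMsg o os x y → x ⊲ y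

layout : ∀ o os X → InCat (block o) (map block os) X → Layout o os X
layout o []        X refl = record
  { lab≡kind = λ _ → refl ; ≼⇔pos≤ = λ _ _ _ → mk⇔ (≤ᵇ⇒≤ _ _) ≤⇒≤ᵇ
  ; ⊲⇒pos< = blockMsg-increasing o ; blockMsg⇒⊲ = λ m → m }
layout o (o′ ∷ os) X (Y , inCatY , concat) = record
  { lab≡kind = lab≡kind ; ≼⇔pos≤ = ≼⇔pos≤ ; ⊲⇒pos< = λ {x} {y} m → catMsg⇒pos< x y (C.others x y m)
  ; blockMsg⇒⊲ = blockMsg⇒⊲ }
  where
  module IH = Layout (layout o′ os Y inCatY)
  module C  = Concat concat
  module X  = CMSC X
  block<rest : ∀ a n → toℕ a < blockSize o + n
  block<rest a n = <-≤-trans (toℕ<n a) (m≤m+n (blockSize o) n)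
  lab≡kind : ∀ x → X.lab x ≡ kindAct (kind o (o′ ∷ os) x)
  lab≡kind (inj₁ a) = C.lab-inh (inj₁ a)
  lab≡kind (inj₂ y) = trans (C.lab-inh (inj₂ y)) (IH.lab≡kind y)
  ≼⇔pos≤ : ∀ x y → owner (X.lab x) ≡ owner (X.lab y) → (x X.≤ y) ⇔ (pos o (o′ ∷ os) x ≤ pos o (o′ ∷ os) y)
  ≼⇔pos≤ (inj₁ a) (inj₁ b) so = ⇔-trans (C.≤ₚ _ _ so) (mk⇔ (≤ᵇ⇒≤ _ _) ≤⇒≤ᵇ)
  ≼⇔pos≤ (inj₂ a) (inj₂ b) so =
    ⇔-trans (C.≤ₚ _ _ so)
      (⇔-trans (IH.≼⇔pos≤ a b (trans (sym (cong owner (C.lab-inh (inj₂ a))))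
                                     (trans so (cong owner (C.lab-inh (inj₂ b))))))
               (mk⇔ (+-monoʳ-≤ (blockSize o)) (+-cancelˡ-≤ (blockSize o) _ _)))
  ≼⇔pos≤ (inj₁ a) (inj₂ b) so = ⇔-trans (C.≤ₚ _ _ so) (mk⇔ (λ _ → <⇒≤ (block<rest a _)) (λ _ → tt))
  ≼⇔pos≤ (inj₂ a) (inj₁ b) so = ⇔-trans (C.≤ₚ _ _ so) (mk⇔ (λ ()) (<⇒≱ (block<rest b _)))
  catMsg⇒pos< : ∀ x y → CatMsg (block o) Y x y → pos o (o′ ∷ os) x < pos o (o′ ∷ os) y
  catMsg⇒pos< (inj₁ a) (inj₁ b) m = blockMsg-increasing o m
  catMsg⇒pos< (inj₂ a) (inj₂ b) m = +-monoʳ-< (blockSize o) (IH.⊲⇒pos< m)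
  catMsg⇒pos< (inj₁ a) (inj₂ b) _ = block<rest a _
  catMsg⇒pos< (inj₂ a) (inj₁ b) ()
  blockMsg⇒⊲ : ∀ {x y} → BlockMsg o (o′ ∷ os) x y → x X.⊲ y
  blockMsg⇒⊲ {inj₁ a} {inj₁ b} m = C.old₁ a b m
  blockMsg⇒⊲ {inj₂ a} {inj₂ b} m = C.old₂ a b (IH.blockMsg⇒⊲ m)

zeroTestEvents : ∀ pre c post o os → pre ++ zero? c ∷ post ≡ o ∷ os →
                 ∃₂ λ x y → pos o os x ≡ length (kindsOf pre) × pos o os y ≡ suc (length (kindsOf pre))
                          × kind o os x ≡ snd c × kind o os y ≡ rcv c × BlockMsg o os x y
zeroTestEvents []        c post _ []        refl = fzero , fsuc fzero , refl , refl , refl , refl , tt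
zeroTestEvents []        c post _ (o′ ∷ os) refl = inj₁ fzero , inj₁ (fsuc fzero) , refl , refl , refl , refl , tt
zeroTestEvents (p ∷ pre) c post o os eq with ∷-injective eq
zeroTestEvents (p ∷ [])      c post _ []        eq | refl , ()
zeroTestEvents (p ∷ _ ∷ pre) c post _ []        eq | refl , ()
zeroTestEvents (p ∷ pre)     c post _ (o′ ∷ os) eq | refl , eq′ with zeroTestEvents pre c post o′ os eq′
... | x , y , pos-x , pos-y , kx , ky , m =
  inj₂ x , inj₂ y , trans (cong (blockSize p +_) pos-x) (sym (length-++ (blockKinds p))) ,
  trans (cong (blockSize p +_) pos-y) (trans (+-suc (blockSize p) _) (cong suc (sym (length-++ (blockKinds p))))) ,
  kx , ky , m

at-op : ∀ pre o post i → at (kindsOf (pre ++ o ∷ post)) (length (kindsOf pre) + toℕ i) ≡ just (kindOf o i)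
at-op pre o post i = trans (cong (λ l → at l (length (kindsOf pre) + toℕ i)) (kindsOf-++ pre (o ∷ post)))
                           (trans (at-++ʳ (kindsOf pre) _ (toℕ i)) (at-lookup (blockKinds o) _ i))

module Backward (o : Op) (os : List Op) (X : CMSC 6 ⊤ (Events o os))
                (inCat : InCat (block o) (map block os) X) (isMSC : IsMSC X) where
  open CMSC X renaming (_≤_ to _≼_)
  open IsCMSC isCMSC using (fifo; ⊲-labels)
  open Layout (layout o os X inCat)

  word : List Kind
  word = kindsOf (o ∷ os)

  kind-at : ∀ x {k} → at word (pos o os x) ≡ just k → kind o os x ≡ k
  kind-at x = at-functional word (at-pos o os x)

  at-kind : ∀ x {k} → kind o os x ≡ k → at word (pos o os x) ≡ just k
  at-kind x eq = trans (at-pos o os x) (cong just eq)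

  event-at-word : ∀ {g} → g < length word → ∃ λ z → pos o os z ≡ g
  event-at-word g<L = event-at o os (subst (_ <_) (sym (size≡length o os)) g<L)

  sameProc : ∀ {x x′ k} → kind o os x ≡ k → kind o os x′ ≡ k → owner (lab x) ≡ owner (lab x′)
  sameProc {x} {x′} kx kx′ = trans (cong owner (trans (lab≡kind x) (cong kindAct kx)))
                                   (sym (cong owner (trans (lab≡kind x′) (cong kindAct kx′))))

  sender-of : ∀ {x y c} → x ⊲ y → kind o os y ≡ rcv c → kind o os x ≡ snd c
  sender-of {x} {y} m ky with ⊲-labels x y m
  ... | _ , _ , _ , lx , ly with trans (sym ly) (trans (lab≡kind y) (cong kindAct ky))
  ...   | refl = kindAct-injective (trans (sym (lab≡kind x)) lx)

  receiver-of : ∀ {x y c} → x ⊲ y → kind o os x ≡ snd c → kind o os y ≡ rcv c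
  receiver-of {x} {y} m kx with ⊲-labels x y m
  ... | _ , _ , _ , lx , ly with trans (sym lx) (trans (lab≡kind x) (cong kindAct kx))
  ...   | refl = kindAct-injective (trans (sym (lab≡kind y)) ly)

  not-rcv-source : ∀ {x y c} → x ⊲ y → kind o os x ≢ rcv c
  not-rcv-source {x} {y} m kx with ⊲-labels x y m
  ... | _ , _ , _ , lx , _ = case trans (sym lx) (trans (lab≡kind x) (cong kindAct kx)) of λ ()

  not-snd-target : ∀ {x y c} → x ⊲ y → kind o os y ≢ snd c
  not-snd-target {x} {y} m ky with ⊲-labels x y m
  ... | _ , _ , _ , _ , ly = case trans (sym ly) (trans (lab≡kind y) (cong kindAct ky)) of λ ()

  -- IsMSC only refutes unmatchedness; the goals these are used for are decidable
  partner-of-rcv : ∀ {y c} → kind o os y ≡ rcv c → ¬ ¬ (∃ λ x → x ⊲ y)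
  partner-of-rcv ky no-x = isMSC _ λ { (_ , inj₁ m) → not-rcv-source m ky ; (x , inj₂ m) → no-x (x , m) }

  partner-of-snd : ∀ {x c} → kind o os x ≡ snd c → ¬ ¬ (∃ λ y → x ⊲ y)
  partner-of-snd kx no-y = isMSC _ λ { (y , inj₁ m) → no-y (y , m) ; (_ , inj₂ m) → not-snd-target m kx }

  fifo-rcv-< : ∀ {x y x′ y′} → x ⊲ y → x′ ⊲ y′ → owner (lab x) ≡ owner (lab x′) → owner (lab y) ≡ owner (lab y′) →
               pos o os y′ < pos o os y → pos o os x′ < pos o os x
  fifo-rcv-< {x} {y} {x′} {y′} m m′ sox soy y′<y = ≰⇒> λ x≤x′ →
    <⇒≱ y′<y (Equivalence.to (≼⇔pos≤ y y′ soy)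
               (Equivalence.to (fifo x y x′ y′ m m′ sox soy) (Equivalence.from (≼⇔pos≤ x x′ sox) x≤x′)))

  fifo-snd-< : ∀ {x y x′ y′} → x ⊲ y → x′ ⊲ y′ → owner (lab x) ≡ owner (lab x′) → owner (lab y) ≡ owner (lab y′) →
               pos o os x′ < pos o os x → pos o os y′ < pos o os y
  fifo-snd-< {x} {y} {x′} {y′} m m′ sox soy x′<x = ≰⇒> λ y≤y′ →
    <⇒≱ x′<x (Equivalence.to (≼⇔pos≤ x x′ sox)
               (Equivalence.from (fifo x y x′ y′ m m′ sox soy) (Equivalence.from (≼⇔pos≤ y y′ soy) y≤y′)))

  -- every receive before y is matched by a send before its partner x
  rcvs≤snds : ∀ r {x y c} → occ (rcv c) word (pos o os y) ≡ r → kind o os y ≡ rcv c → x ⊲ y →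
              r ≤ occ (snd c) word (pos o os x)
  rcvs≤snds zero    _ _ _ = z≤n
  rcvs≤snds (suc r) {x} {y} {c} occ-y ky m
    with occ-index (rcv c) word (pos o os y) (subst (r <_) (sym occ-y) ≤-refl)
  ... | g′ , g′<y , at-g′ , occ-g′ with event-at-word (at⇒< word at-g′)
  ... | y′ , refl = decidable-stable (suc r ≤? _) λ r≰ → partner-of-rcv ky′ λ (x′ , m′) → r≰ (earlierRcv x′ m′)
    where
    ky′ : kind o os y′ ≡ rcv c
    ky′ = kind-at y′ at-g′
    earlierRcv : ∀ x′ → x′ ⊲ y′ → suc r ≤ occ (snd c) word (pos o os x)
    earlierRcv x′ m′ = <-≤-trans (s≤s (rcvs≤snds r occ-g′ ky′ m′))
                   (occ-strict (snd c) word (at-kind x′ kx′)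
                     (fifo-rcv-< m m′ (sameProc (sender-of m ky) kx′) (sameProc ky ky′) g′<y))
      where
      kx′ : kind o os x′ ≡ snd c
      kx′ = sender-of m′ ky′

  snds≤rcvs : ∀ s {x y c} → occ (snd c) word (pos o os x) ≡ s → kind o os x ≡ snd c → x ⊲ y →
              s ≤ occ (rcv c) word (pos o os y)
  snds≤rcvs zero    _ _ _ = z≤n
  snds≤rcvs (suc s) {x} {y} {c} occ-x kx m
    with occ-index (snd c) word (pos o os x) (subst (s <_) (sym occ-x) ≤-refl)
  ... | g′ , g′<x , at-g′ , occ-g′ with event-at-word (at⇒< word at-g′)
  ... | x′ , refl = decidable-stable (suc s ≤? _) λ s≰ → partner-of-snd kx′ λ (y′ , m′) → s≰ (earlierSnd y′ m′)
    where
    kx′ : kind o os x′ ≡ snd c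
    kx′ = kind-at x′ at-g′
    earlierSnd : ∀ y′ → x′ ⊲ y′ → suc s ≤ occ (rcv c) word (pos o os y)
    earlierSnd y′ m′ = <-≤-trans (s≤s (snds≤rcvs s occ-g′ kx′ m′))
                   (occ-strict (rcv c) word (at-kind y′ ky′)
                     (fifo-snd-< m m′ (sameProc kx kx′) (sameProc (receiver-of m kx) ky′) g′<x))
      where
      ky′ : kind o os y′ ≡ rcv c
      ky′ = receiver-of m′ kx′

  dec-enabled : ∀ pre c post → pre ++ dec c ∷ post ≡ o ∷ os →
                occ (rcv c) word (length (kindsOf pre)) < occ (snd c) word (length (kindsOf pre))
  dec-enabled pre c post eq = decidable-stable (_ <? _) λ ≮ → partner-of-rcv ky λ (x , m) → ≮ (enabled x m)
    where
    P : ℕ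
    P = length (kindsOf pre)
    at-dec : at word P ≡ just (rcv c)
    at-dec = subst (λ w → at (kindsOf w) P ≡ just (rcv c)) eq
                   (trans (cong (at (kindsOf (pre ++ dec c ∷ post))) (sym (+-identityʳ P)))
                          (at-op pre (dec c) post fzero))
    y : Events o os
    y = proj₁ (event-at-word (at⇒< word at-dec))
    pos-y : pos o os y ≡ P
    pos-y = proj₂ (event-at-word (at⇒< word at-dec))
    ky : kind o os y ≡ rcv c
    ky = kind-at y (subst (λ g → at word g ≡ just (rcv c)) (sym pos-y) at-dec)
    enabled : ∀ x → x ⊲ y → occ (rcv c) word P < occ (snd c) word P
    enabled x m = subst₂ _<_ (cong (occ (rcv c) word) pos-y) (cong (occ (snd c) word) pos-y)
      (≤-<-trans (rcvs≤snds _ refl ky m) (occ-strict (snd c) word (at-kind x (sender-of m ky)) (⊲⇒pos< m)))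

  empty-at-test : ∀ pre c post → pre ++ zero? c ∷ post ≡ o ∷ os →
                  occ (snd c) word (length (kindsOf pre)) ≡ occ (rcv c) word (length (kindsOf pre))
  empty-at-test pre c post eq with zeroTestEvents pre c post o os eq
  ... | x , y , pos-x , pos-y , kx , ky , bm = ≤-antisym
    (subst₂ _≤_ (cong (occ (snd c) word) pos-x) rcv-y (snds≤rcvs _ refl kx m))
    (subst₂ _≤_ rcv-y (cong (occ (snd c) word) pos-x) (rcvs≤snds _ refl ky m))
    where
    m : x ⊲ y
    m = blockMsg⇒⊲ bm
    rcv-y : occ (rcv c) word (pos o os y) ≡ occ (rcv c) word (length (kindsOf pre))
    rcv-y = trans (cong (occ (rcv c) word) pos-y)
                  (occ-suc-other (rcv c) word (subst (λ g → at word g ≡ _) pos-x (at-kind x kx)) (λ ()))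

-- Three-counter machines and their HMSCs

Counters : Set
Counters = ℕ × ℕ × ℕ

zeros : Counters
zeros = 0 , 0 , 0

get : Counter → Counters → ℕ
get fzero               (a , _ , _) = a
get (fsuc fzero)        (_ , b , _) = b
get (fsuc (fsuc fzero)) (_ , _ , c) = c

incr : Counter → Counters → Counters
incr fzero               (a , b , c) = suc a , b , c
incr (fsuc fzero)        (a , b , c) = a , suc b , c
incr (fsuc (fsuc fzero)) (a , b , c) = a , b , suc c

get-zeros : ∀ c → get c zeros ≡ 0
get-zeros fzero               = refl
get-zeros (fsuc fzero)        = refl
get-zeros (fsuc (fsuc fzero)) = refl

get-incr : ∀ c c′ v → get c (incr c′ v) ≡ hit (snd c) (snd c′) + get c v
get-incr fzero               fzero               _ = refl
get-incr fzero               (fsuc fzero)        _ = refl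
get-incr fzero               (fsuc (fsuc fzero)) _ = refl
get-incr (fsuc fzero)        fzero               _ = refl
get-incr (fsuc fzero)        (fsuc fzero)        _ = refl
get-incr (fsuc fzero)        (fsuc (fsuc fzero)) _ = refl
get-incr (fsuc (fsuc fzero)) fzero               _ = refl
get-incr (fsuc (fsuc fzero)) (fsuc fzero)        _ = refl
get-incr (fsuc (fsuc fzero)) (fsuc (fsuc fzero)) _ = refl

get-suc⇒incr : ∀ c v {m} → get c v ≡ suc m → ∃ λ v′ → v ≡ incr c v′
get-suc⇒incr fzero               (suc a , b , c) _ = (a , b , c) , refl
get-suc⇒incr (fsuc fzero)        (a , suc b , c) _ = (a , b , c) , refl
get-suc⇒incr (fsuc (fsuc fzero)) (a , b , suc c) _ = (a , b , c) , refl

data Exec : Op → Counters → Counters → Set where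
  exec-inc  : ∀ c v → Exec (inc c) v (incr c v)
  exec-dec  : ∀ c v → Exec (dec c) (incr c v) v
  exec-zero : ∀ c v → get c v ≡ 0 → Exec (zero? c) v v

exec-balance : ∀ {o v v′} → Exec o v v′ → ∀ c →
               get c v + total (snd c) (blockKinds o) ≡ get c v′ + total (rcv c) (blockKinds o)
exec-balance (exec-inc c′ v) c = begin
  get c v + (hit (snd c) (snd c′) + 0) ≡⟨ cong (get c v +_) (+-identityʳ _) ⟩
  get c v + hit (snd c) (snd c′)       ≡⟨ +-comm (get c v) _ ⟩
  hit (snd c) (snd c′) + get c v       ≡⟨ get-incr c c′ v ⟨
  get c (incr c′ v)                    ≡⟨ +-identityʳ _ ⟨
  get c (incr c′ v) + 0                ∎
  where open ≡-Reasoning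
exec-balance (exec-dec c′ v) c = begin
  get c (incr c′ v) + 0                ≡⟨ +-identityʳ _ ⟩
  get c (incr c′ v)                    ≡⟨ get-incr c c′ v ⟩
  hit (snd c) (snd c′) + get c v       ≡⟨ +-comm _ (get c v) ⟩
  get c v + hit (snd c) (snd c′)       ≡⟨ cong (get c v +_) (+-identityʳ _) ⟨
  get c v + (hit (rcv c) (rcv c′) + 0) ∎
  where open ≡-Reasoning
exec-balance (exec-zero c′ v _) c = refl

balance-trans : ∀ a s₁ s₂ b r₁ c r₂ → a + s₁ ≡ b + r₁ → b + s₂ ≡ c + r₂ → a + (s₁ + s₂) ≡ c + (r₁ + r₂)
balance-trans a s₁ s₂ b r₁ c r₂ h₁ h₂ = begin
  a + (s₁ + s₂)  ≡⟨ +-assoc a s₁ s₂ ⟨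
  a + s₁ + s₂    ≡⟨ cong (_+ s₂) h₁ ⟩
  b + r₁ + s₂    ≡⟨ cong (_+ s₂) (+-comm b r₁) ⟩
  r₁ + b + s₂    ≡⟨ +-assoc r₁ b s₂ ⟩
  r₁ + (b + s₂)  ≡⟨ cong (r₁ +_) h₂ ⟩
  r₁ + (c + r₂)  ≡⟨ x∙yz≈y∙xz r₁ c r₂ ⟩
  c + (r₁ + r₂)  ∎
  where open ≡-Reasoning

occ-prefix : ∀ k pre rest → occ k (kindsOf (pre ++ rest)) (length (kindsOf pre)) ≡ total k (kindsOf pre)
occ-prefix k pre rest = trans (cong (λ l → occ k l (length (kindsOf pre))) (kindsOf-++ pre rest))
                              (occ-++ˡ k (kindsOf pre) (kindsOf rest) ≤-refl)

blockAt : ∀ W g {k} → at (kindsOf W) g ≡ just k →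
          ∃ λ pre → ∃ λ o → ∃ λ post → Σ (Fin (blockSize o)) λ i →
            pre ++ o ∷ post ≡ W × g ≡ length (kindsOf pre) + toℕ i × kindOf o i ≡ k
blockAt (inc c   ∷ W) zero          refl = [] , inc c , W , fzero , refl , refl , refl
blockAt (dec c   ∷ W) zero          refl = [] , dec c , W , fzero , refl , refl , refl
blockAt (zero? c ∷ W) zero          refl = [] , zero? c , W , fzero , refl , refl , refl
blockAt (zero? c ∷ W) (suc zero)    refl = [] , zero? c , W , fsuc fzero , refl , refl , refl
blockAt (inc c   ∷ W) (suc g)       eq with blockAt W g eq
... | pre , o , post , i , eq′ , g≡ , k≡ = inc c ∷ pre , o , post , i , cong (inc c ∷_) eq′ , cong suc g≡ , k≡
blockAt (dec c   ∷ W) (suc g)       eq with blockAt W g eq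
... | pre , o , post , i , eq′ , g≡ , k≡ = dec c ∷ pre , o , post , i , cong (dec c ∷_) eq′ , cong suc g≡ , k≡
blockAt (zero? c ∷ W) (suc (suc g)) eq with blockAt W g eq
... | pre , o , post , i , eq′ , g≡ , k≡ =
  zero? c ∷ pre , o , post , i , cong (zero? c ∷_) eq′ , cong (suc ∘ suc) g≡ , k≡

record CounterMachine : Set where
  field
    nS          : ℕ
    start       : Fin nS
    transitions : List (Fin nS × Op × Fin nS)
    final       : Fin nS → Bool

module Machine (M : CounterMachine) where
  open CounterMachine M

  infixr 5 _∷⟨_⟩_
  data Run : Fin nS → Counters → Fin nS → Counters → List Op → Set where
    done    : ∀ {s v} → Run s v s v []
    _∷⟨_⟩_ : ∀ {s v s₁ v₁ s′ v′ o os} → (s , o , s₁) ∈ transitions → Exec o v v₁ →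
              Run s₁ v₁ s′ v′ os → Run s v s′ v′ (o ∷ os)

  infixr 5 _⨾_
  data Trace : Fin nS → Fin nS → List Op → Set where
    edge : ∀ {s o s′} → (s , o , s′) ∈ transitions → Trace s s′ (o ∷ [])
    _⨾_  : ∀ {s o s₁ s′ os} → (s , o , s₁) ∈ transitions → Trace s₁ s′ os → Trace s s′ (o ∷ os)

  hmsc : HMSC 6
  hmsc = record { nS = nS ; ι = start ; R = map (λ (s , o , s′) → s , block o , s′) transitions
                ; F = final ; Fω = λ _ → false }

  transition⇒R : ∀ {s o s′} → (s , o , s′) ∈ transitions → (s , block o , s′) ∈ HMSC.R hmsc
  transition⇒R = ∈-map⁺ _

  R⇒transition : ∀ {s M s′} → (s , M , s′) ∈ HMSC.R hmsc → ∃ λ o → M ≡ block o × (s , o , s′) ∈ transitions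
  R⇒transition m with ∈-map⁻ _ m
  ... | (_ , o , _) , t , refl = o , refl , t

  _++ᵣ_ : ∀ {s v s₁ v₁ s₂ v₂ W₁ W₂} → Run s v s₁ v₁ W₁ → Run s₁ v₁ s₂ v₂ W₂ → Run s v s₂ v₂ (W₁ ++ W₂)
  done           ++ᵣ r₂ = r₂
  (t ∷⟨ e ⟩ r₁) ++ᵣ r₂ = t ∷⟨ e ⟩ (r₁ ++ᵣ r₂)

  run-split : ∀ pre {rest s v s′ v′} → Run s v s′ v′ (pre ++ rest) →
              ∃₂ λ s₁ v₁ → Run s v s₁ v₁ pre × Run s₁ v₁ s′ v′ rest
  run-split []        r               = _ , _ , done , r
  run-split (o ∷ pre) (t ∷⟨ e ⟩ r) with run-split pre r
  ... | s₁ , v₁ , r₁ , r₂ = s₁ , v₁ , t ∷⟨ e ⟩ r₁ , r₂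

  run-balance : ∀ {s v s′ v′ W} → Run s v s′ v′ W → ∀ c →
                get c v + total (snd c) (kindsOf W) ≡ get c v′ + total (rcv c) (kindsOf W)
  run-balance done c = refl
  run-balance {v = v} {v′ = v′} (_∷⟨_⟩_ {v₁ = v₁} {o = o} {os = os} _ e r) c = begin
    get c v + total (snd c) (blockKinds o ++ kindsOf os)
      ≡⟨ cong (get c v +_) (total-++ (snd c) (blockKinds o) (kindsOf os)) ⟩
    get c v + (total (snd c) (blockKinds o) + total (snd c) (kindsOf os))
      ≡⟨ balance-trans (get c v) _ _ (get c v₁) _ (get c v′) _ (exec-balance e c) (run-balance r c) ⟩
    get c v′ + (total (rcv c) (blockKinds o) + total (rcv c) (kindsOf os))
      ≡⟨ cong (get c v′ +_) (total-++ (rcv c) (blockKinds o) (kindsOf os)) ⟨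
    get c v′ + total (rcv c) (blockKinds o ++ kindsOf os) ∎
    where open ≡-Reasoning

  run⇒path : ∀ {s v s′ v′ o os} → Run s v s′ v′ (o ∷ os) →
             Σ (FPath hmsc s s′) λ ρ → first hmsc ρ ≡ block o × rest hmsc ρ ≡ map block os
  run⇒path (t ∷⟨ _ ⟩ done)            = one (transition⇒R t) , refl , refl
  run⇒path (t ∷⟨ _ ⟩ r@(_ ∷⟨ _ ⟩ _)) with run⇒path r
  ... | ρ , first≡ , rest≡ = step (transition⇒R t) ρ , refl , cong₂ _∷_ first≡ rest≡

  path⇒trace : ∀ {s s′} (ρ : FPath hmsc s s′) →
               ∃₂ λ o os → Trace s s′ (o ∷ os) × first hmsc ρ ≡ block o × rest hmsc ρ ≡ map block os
  path⇒trace (one m) with R⇒transition m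
  ... | o , refl , t = o , [] , edge t , refl , refl
  path⇒trace (step m ρ) with R⇒transition m | path⇒trace ρ
  ... | o , refl , t | o′ , os , τ , first≡ , rest≡ = o , o′ ∷ os , t ⨾ τ , refl , cong₂ _∷_ first≡ rest≡

  CountersAfter : List Op → Counters → Set
  CountersAfter pre v = ∀ c → get c v + total (rcv c) (kindsOf pre) ≡ total (snd c) (kindsOf pre)

  exec-after : ∀ pre o post {s s′ v′} → Run s zeros s′ v′ (pre ++ o ∷ post) →
               ∃₂ λ v₁ v₂ → CountersAfter pre v₁ × Exec o v₁ v₂
  exec-after pre o post r with run-split pre r
  ... | _ , v₁ , r₁ , (_ ∷⟨ e ⟩ _) = v₁ , _ , after , e
    where
    after : CountersAfter pre v₁
    after c = sym (trans (cong (_+ total (snd c) (kindsOf pre)) (sym (get-zeros c))) (run-balance r₁ c))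

  get-incr-self : ∀ c v → get c (incr c v) ≡ suc (get c v)
  get-incr-self c v = trans (get-incr c c v) (cong (_+ get c v) (hit-self (snd c)))

  run⇒rcv-after-snd : ∀ {W s s′ v′} → Run s zeros s′ v′ W → ∀ g c → at (kindsOf W) g ≡ just (rcv c) →
                      occ (rcv c) (kindsOf W) g < occ (snd c) (kindsOf W) g
  run⇒rcv-after-snd {W} r g c at-g with blockAt W g at-g
  ... | pre , o , post , i , refl , refl , k≡ with exec-after pre o post r
  ... | _ , _ , _ , exec-inc _ _ with i | k≡
  ...   | fzero | ()
  run⇒rcv-after-snd r _ c _ | pre , _ , post , i , refl , refl , k≡ | _ , v₂ , after , exec-dec _ _ with i | k≡
  ...   | fzero | refl = begin-strict
    occ (rcv c) word (P + 0)         ≡⟨ cong (occ (rcv c) word) (+-identityʳ P) ⟩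
    occ (rcv c) word P               ≡⟨ occ-prefix (rcv c) pre _ ⟩
    total (rcv c) (kindsOf pre)      <⟨ s≤s (m≤n+m _ (get c v₂)) ⟩
    suc (get c v₂) + total (rcv c) (kindsOf pre) ≡⟨ cong (_+ _) (get-incr-self c v₂) ⟨
    get c (incr c v₂) + total (rcv c) (kindsOf pre) ≡⟨ after c ⟩
    total (snd c) (kindsOf pre)      ≡⟨ occ-prefix (snd c) pre _ ⟨
    occ (snd c) word P               ≡⟨ cong (occ (snd c) word) (+-identityʳ P) ⟨
    occ (snd c) word (P + 0)         ∎
    where
    open ≤-Reasoning
    P : ℕ
    P = length (kindsOf pre)
    word : List Kind
    word = kindsOf (pre ++ dec c ∷ post)
  run⇒rcv-after-snd r _ c _ | pre , _ , post , i , refl , refl , k≡ | v₁ , _ , after , exec-zero _ _ z with i | k≡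
  ...   | fsuc fzero | refl = begin-strict
    occ (rcv c) word (P + 1)         ≡⟨ cong (occ (rcv c) word) (+-comm P 1) ⟩
    occ (rcv c) word (suc P)         ≡⟨ occ-suc-other (rcv c) word at-P (λ ()) ⟩
    occ (rcv c) word P               ≡⟨ occ-prefix (rcv c) pre _ ⟩
    total (rcv c) (kindsOf pre)      ≡⟨ cong (_+ _) z ⟨
    get c v₁ + total (rcv c) (kindsOf pre) ≡⟨ after c ⟩
    total (snd c) (kindsOf pre)      <⟨ n<1+n _ ⟩
    suc (total (snd c) (kindsOf pre)) ≡⟨ cong suc (occ-prefix (snd c) pre _) ⟨
    suc (occ (snd c) word P)         ≡⟨ occ-suc-self (snd c) word at-P ⟨
    occ (snd c) word (suc P)         ≡⟨ cong (occ (snd c) word) (+-comm P 1) ⟨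
    occ (snd c) word (P + 1)         ∎
    where
    open ≤-Reasoning
    P : ℕ
    P = length (kindsOf pre)
    word : List Kind
    word = kindsOf (pre ++ zero? c ∷ post)
    at-P : at word P ≡ just (snd c)
    at-P = trans (cong (at word) (sym (+-identityʳ P))) (at-op pre (zero? c) post fzero)

  run⇒consistent : ∀ {W s s′} → Run s zeros s′ zeros W → CounterConsistent W
  run⇒consistent {W} r = record
    { rcv-after-snd = run⇒rcv-after-snd r
    ; balanced      = λ c → +-cancelˡ-≡ (get c zeros) _ _ (run-balance r c)
    ; empty-at-test = empty-at-test }
    where
    empty-at-test : ∀ pre c post → pre ++ zero? c ∷ post ≡ W →
                    occ (snd c) (kindsOf W) (length (kindsOf pre)) ≡ occ (rcv c) (kindsOf W) (length (kindsOf pre))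
    empty-at-test pre c post refl with exec-after pre (zero? c) post r
    ... | v₁ , _ , after , exec-zero _ _ z = begin
      occ (snd c) (kindsOf W) (length (kindsOf pre)) ≡⟨ occ-prefix (snd c) pre _ ⟩
      total (snd c) (kindsOf pre)                   ≡⟨ after c ⟨
      get c v₁ + total (rcv c) (kindsOf pre)        ≡⟨ cong (_+ _) z ⟩
      total (rcv c) (kindsOf pre)                   ≡⟨ occ-prefix (rcv c) pre _ ⟨
      occ (rcv c) (kindsOf W) (length (kindsOf pre)) ∎
      where open ≡-Reasoning

  module FromDiscipline (W : List Op)
    (dec-enabled   : ∀ pre c post → pre ++ dec c ∷ post ≡ W →
                     occ (rcv c) (kindsOf W) (length (kindsOf pre)) < occ (snd c) (kindsOf W) (length (kindsOf pre)))
    (empty-at-test : ∀ pre c post → pre ++ zero? c ∷ post ≡ W →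
                     occ (snd c) (kindsOf W) (length (kindsOf pre)) ≡ occ (rcv c) (kindsOf W) (length (kindsOf pre)))
    where

    exec-next : ∀ pre o post → pre ++ o ∷ post ≡ W → ∀ v → CountersAfter pre v → ∃ λ v′ → Exec o v v′
    exec-next pre (inc c) post eq v after = incr c v , exec-inc c v
    exec-next pre (dec c) post refl v after with get c v in get≡
    ... | suc m = let v′ , v≡ = get-suc⇒incr c v get≡ in v′ , subst (λ u → Exec (dec c) u v′) (sym v≡) (exec-dec c v′)
    ... | zero  = ⊥-elim (<-irrefl (trans (sym (cong (_+ _) get≡)) (after c)) rcv<snd)
      where
      rcv<snd : total (rcv c) (kindsOf pre) < total (snd c) (kindsOf pre)
      rcv<snd = subst₂ _<_ (occ-prefix (rcv c) pre _) (occ-prefix (snd c) pre _) (dec-enabled pre c post refl)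
    exec-next pre (zero? c) post refl v after = v , exec-zero c v (+-cancelʳ-≡ _ (get c v) 0 (trans (after c) snd≡rcv))
      where
      snd≡rcv : total (snd c) (kindsOf pre) ≡ total (rcv c) (kindsOf pre)
      snd≡rcv = trans (sym (occ-prefix (snd c) pre _))
                      (trans (empty-at-test pre c post refl) (occ-prefix (rcv c) pre _))

    countersAfter-snoc : ∀ pre o {v v′} → CountersAfter pre v → Exec o v v′ → CountersAfter (pre ++ o ∷ []) v′
    countersAfter-snoc pre o {v} {v′} after e c = begin
      get c v′ + total (rcv c) (kindsOf (pre ++ o ∷ []))   ≡⟨ cong (get c v′ +_) (total-snoc (rcv c)) ⟩
      get c v′ + (total (rcv c) (kindsOf pre) + rO)        ≡⟨ cong (get c v′ +_) (+-comm _ rO) ⟩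
      get c v′ + (rO + total (rcv c) (kindsOf pre))        ≡⟨ +-assoc (get c v′) rO _ ⟨
      get c v′ + rO + total (rcv c) (kindsOf pre)          ≡⟨ cong (_+ total (rcv c) (kindsOf pre)) (exec-balance e c) ⟨
      get c v + sO + total (rcv c) (kindsOf pre)           ≡⟨ +-assoc (get c v) sO (total (rcv c) (kindsOf pre)) ⟩
      get c v + (sO + total (rcv c) (kindsOf pre))         ≡⟨ x∙yz≈y∙xz (get c v) sO _ ⟩
      sO + (get c v + total (rcv c) (kindsOf pre))         ≡⟨ cong (sO +_) (after c) ⟩
      sO + total (snd c) (kindsOf pre)                     ≡⟨ +-comm sO _ ⟩
      total (snd c) (kindsOf pre) + sO                     ≡⟨ total-snoc (snd c) ⟨
      total (snd c) (kindsOf (pre ++ o ∷ []))              ∎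
      where
      open ≡-Reasoning
      sO rO : ℕ
      sO = total (snd c) (blockKinds o)
      rO = total (rcv c) (blockKinds o)
      total-snoc : ∀ k → total k (kindsOf (pre ++ o ∷ [])) ≡ total k (kindsOf pre) + total k (blockKinds o)
      total-snoc k = trans (cong (total k) (kindsOf-++ pre (o ∷ [])))
                           (trans (total-++ k (kindsOf pre) (blockKinds o ++ []))
                                  (cong (λ l → total k (kindsOf pre) + total k l) (++-identityʳ (blockKinds o))))

    trace⇒run : ∀ pre rest {s s′} → Trace s s′ rest → pre ++ rest ≡ W → ∀ v → CountersAfter pre v →
                ∃ λ v′ → Run s v s′ v′ rest
    trace⇒run pre (o ∷ []) (edge t) eq v after with exec-next pre o [] eq v after
    ... | v₁ , e = v₁ , t ∷⟨ e ⟩ done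
    trace⇒run pre (o ∷ rest) (t ⨾ τ) eq v after with exec-next pre o rest eq v after
    ... | v₁ , e with trace⇒run (pre ++ o ∷ []) rest τ (trans (++-assoc pre (o ∷ []) rest) eq) v₁
                                 (countersAfter-snoc pre o after e)
    ...   | v′ , r = v′ , t ∷⟨ e ⟩ r

  MSCOf : FCMSC 6 ⊤ → List (FCMSC 6 ⊤) → Set₁
  MSCOf M Ms = Σ (CMSC 6 ⊤ (EvList M Ms)) λ X → InCat M Ms X × IsMSC X

  accepting-run⇒nonEmpty : ∀ {s o os} → Run start zeros s zeros (o ∷ os) → T (final s) → NonEmptyLang hmsc
  accepting-run⇒nonEmpty {s} {o} {os} r final-s with run⇒path r
  ... | ρ , first≡ , rest≡ =
    inj₁ (s , final-s , ρ , subst₂ MSCOf (sym first≡) (sym rest≡) (Forward.msc (o ∷ os) (run⇒consistent r) o os refl))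

  nonEmpty⇒accepting-run : NonEmptyLang hmsc → ∃ λ s → ∃ λ v → ∃ λ W → Run start zeros s v W × T (final s)
  nonEmpty⇒accepting-run (inj₂ (_ , _ , infinitelyOften , _)) with infinitelyOften 0
  ... | _ , _ , ()
  nonEmpty⇒accepting-run (inj₁ (s , final-s , ρ , msc)) with path⇒trace ρ
  ... | o , os , τ , first≡ , rest≡ with subst₂ MSCOf first≡ rest≡ msc
  ...   | X , inCat , isMSC = s , _ , o ∷ os , proj₂ (trace⇒run [] (o ∷ os) τ refl zeros from-zero) , final-s
    where
    open Backward o os X inCat isMSC using (dec-enabled; empty-at-test)
    open FromDiscipline (o ∷ os) dec-enabled empty-at-test
    from-zero : CountersAfter [] zeros
    from-zero c = trans (+-identityʳ _) (get-zeros c)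

-- A three-counter machine simulating a Turing machine on blank tape

bitℕ : Bool → ℕ
bitℕ false = 0
bitℕ true  = 1

bitFin : Bool → Fin 2
bitFin false = fzero
bitFin true  = fsuc fzero

finBit : Fin 2 → Bool
finBit fzero    = false
finBit (fsuc _) = true

finBit-bitFin : ∀ b → finBit (bitFin b) ≡ b
finBit-bitFin false = refl
finBit-bitFin true  = refl

-- the value of a tape half, nearest cell least significant
value : List Bool → ℕ
value []      = 0
value (b ∷ l) = bitℕ b + 2 * value l

-- phases are numbers, named by pattern synonyms, so that states are numbered by Fin nS
Phase : Set
Phase = Fin 14

pattern ready    = fzero
pattern moveX    = fsuc ready
pattern moveX′   = fsuc moveX
pattern double   = fsuc moveX′
pattern double′  = fsuc double
pattern double″  = fsuc double′
pattern write    = fsuc double″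
pattern moveY    = fsuc write
pattern moveY′   = fsuc moveY
pattern halve    = fsuc moveY′
pattern halve′   = fsuc halve
pattern halve″   = fsuc halve′
pattern drain    = fsuc halve″
pattern finished = fsuc drain

left right tmp : Counter
left  = fzero
right = fsuc fzero
tmp   = fsuc (fsuc fzero)

-- the counters holding the tape half the head leaves (X) and the one it enters (Y)
counterX counterY : Dir → Counter
counterX R = left
counterX L = right
counterY R = right
counterY L = left

arrange : Dir → (x y t : ℕ) → Counters
arrange R x y t = x , y , t
arrange L x y t = y , x , t

module Simulation (M : TM) where
  open TM M

  Move : Set
  Move = Fin (suc Q) × Bool × Dir

  State : Set
  State = Fin (suc Q) × Bool × Phase

  nS : ℕ
  nS = suc Q * (2 * 14)

  encode : State → Fin nS
  encode (q , h , p) = combine q (combine (bitFin h) p)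

  decode : Fin nS → State
  decode s = proj₁ qr , finBit (proj₁ hp) , proj₂ hp
    where
    qr : Fin (suc Q) × Fin (2 * 14)
    qr = remQuot {suc Q} (2 * 14) s
    hp : Fin 2 × Phase
    hp = remQuot {2} 14 (proj₂ qr)

  decode-encode : ∀ st → decode (encode st) ≡ st
  decode-encode (q , h , p) = begin
    decode (combine q (combine (bitFin h) p))
      ≡⟨ cong (λ r → proj₁ r , finBit (proj₁ (remQuot {2} 14 (proj₂ r))) , proj₂ (remQuot {2} 14 (proj₂ r)))
              (remQuot-combine q (combine (bitFin h) p)) ⟩
    q , finBit (proj₁ (remQuot {2} 14 (combine (bitFin h) p))) , proj₂ (remQuot {2} 14 (combine (bitFin h) p))
      ≡⟨ cong (λ r → q , finBit (proj₁ r) , proj₂ r) (remQuot-combine (bitFin h) p) ⟩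
    q , finBit (bitFin h) , p
      ≡⟨ cong (λ b → q , b , p) (finBit-bitFin h) ⟩
    q , h , p ∎
    where open ≡-Reasoning

  -- In state (q, h, ready) the counters hold (value left, value right, 0). A step writing b and
  -- moving in direction d moves X into tmp, doubles it back, adds b (X := b + 2X), moves Y into
  -- tmp and halves it back (Y := Y div 2); the parity of Y is the new head symbol. On halting
  -- the counters are drained to zero.
  program : Fin (suc Q) → Bool → Phase → Maybe Move → List (Op × State)
  program q h drain    _       = (dec right , q , h , drain) ∷ (zero? right , q , h , finished) ∷ []
  program q h finished _       = []
  program q h ready    nothing = (dec left , q , h , ready) ∷ (zero? left , q , h , drain) ∷ []
  program q h _        nothing = []
  program q h ready    (just (q′ , b , d)) = (zero? tmp , q , h , moveX) ∷ []
  program q h moveX    (just (q′ , b , d)) =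
    (dec (counterX d) , q , h , moveX′) ∷ (zero? (counterX d) , q , h , double) ∷ []
  program q h moveX′   (just (q′ , b , d)) = (inc tmp , q , h , moveX) ∷ []
  program q h double   (just (q′ , b , d)) = (dec tmp , q , h , double′) ∷ (zero? tmp , q , h , write) ∷ []
  program q h double′  (just (q′ , b , d)) = (inc (counterX d) , q , h , double″) ∷ []
  program q h double″  (just (q′ , b , d)) = (inc (counterX d) , q , h , double) ∷ []
  program q h write    (just (q′ , true , d))  = (inc (counterX d) , q , h , moveY) ∷ []
  program q h write    (just (q′ , false , d)) = (zero? tmp , q , h , moveY) ∷ []
  program q h moveY    (just (q′ , b , d)) =
    (dec (counterY d) , q , h , moveY′) ∷ (zero? (counterY d) , q , h , halve) ∷ []
  program q h moveY′   (just (q′ , b , d)) = (inc tmp , q , h , moveY) ∷ []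
  program q h halve    (just (q′ , b , d)) = (dec tmp , q , h , halve′) ∷ (zero? tmp , q′ , false , ready) ∷ []
  program q h halve′   (just (q′ , b , d)) = (dec tmp , q , h , halve″) ∷ (zero? tmp , q′ , true , ready) ∷ []
  program q h halve″   (just (q′ , b , d)) = (inc (counterY d) , q , h , halve) ∷ []

  next : State → List (Op × State)
  next (q , h , p) = program q h p (δ q h)

  isFinished : Phase → Bool
  isFinished finished = true
  isFinished _        = false

  edgeFrom : Fin nS → Op × State → Fin nS × Op × Fin nS
  edgeFrom s (o , st′) = s , o , encode st′

  edgesFrom : Fin nS → List (Fin nS × Op × Fin nS)
  edgesFrom s = map (edgeFrom s) (next (decode s))

  machine : CounterMachine
  machine = record
    { nS          = nS
    ; start       = encode (fzero , false , ready)
    ; transitions = concatMap edgesFrom (allFin nS)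
    ; final       = isFinished ∘ proj₂ ∘ proj₂ ∘ decode }

  open CounterMachine machine using (transitions)
  open Machine machine

  transition⁺ : ∀ st {o st′} → (o , st′) ∈ next st → (encode st , o , encode st′) ∈ transitions
  transition⁺ st {o} {st′} m = ∈-concatMap⁺ edgesFrom (lose (∈-allFin (encode st)) (∈-map⁺ (edgeFrom (encode st)) m′))
    where
    m′ : (o , st′) ∈ next (decode (encode st))
    m′ = subst (λ z → (o , st′) ∈ next z) (sym (decode-encode st)) m

  transition⁻ : ∀ {s o s′} → (s , o , s′) ∈ transitions → (o , decode s′) ∈ next (decode s)
  transition⁻ {s} {o} {s′} m with find (∈-concatMap⁻ edgesFrom {xs = allFin nS} m)
  ... | s₀ , _ , m₀ with ∈-map⁻ (edgeFrom s₀) m₀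
  ...   | (o , st′) , m₁ , refl = subst (λ z → (o , z) ∈ next (decode s₀)) (sym (decode-encode st′)) m₁

  valueX valueY : Dir → Config M → ℕ
  valueX R c = value (Config.left c)
  valueX L c = value (Config.right c)
  valueY R c = value (Config.right c)
  valueY L c = value (Config.left c)

  tapeCounters : Config M → Counters
  tapeCounters c = value (Config.left c) , value (Config.right c) , 0

  tapeCounters-arrange : ∀ d c → tapeCounters c ≡ arrange d (valueX d c) (valueY d c) 0
  tapeCounters-arrange R c = refl
  tapeCounters-arrange L c = refl

  Reached : Config M → Set
  Reached c = ∃ λ n → iterTM n (initial M) ≡ just c

  ReachedAt : Fin (suc Q) → Bool → Config M → Set
  ReachedAt q h c = Reached c × Config.state c ≡ q × Config.head c ≡ h

  -- x, y: the values of the tape halves X and Y; cx, cy, ct: the counters X, Y and tmp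
  PhaseInv : Phase → Bool → (x y cx cy ct : ℕ) → Set
  PhaseInv moveX   b x y cx cy ct = cx + ct ≡ x × cy ≡ y
  PhaseInv moveX′  b x y cx cy ct = suc (cx + ct) ≡ x × cy ≡ y
  PhaseInv double  b x y cx cy ct = cx + 2 * ct ≡ 2 * x × cy ≡ y
  PhaseInv double′ b x y cx cy ct = suc (suc (cx + 2 * ct)) ≡ 2 * x × cy ≡ y
  PhaseInv double″ b x y cx cy ct = suc (cx + 2 * ct) ≡ 2 * x × cy ≡ y
  PhaseInv write   b x y cx cy ct = cx ≡ 2 * x × ct ≡ 0 × cy ≡ y
  PhaseInv moveY   b x y cx cy ct = cx ≡ bitℕ b + 2 * x × cy + ct ≡ y
  PhaseInv moveY′  b x y cx cy ct = cx ≡ bitℕ b + 2 * x × suc (cy + ct) ≡ y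
  PhaseInv halve   b x y cx cy ct = cx ≡ bitℕ b + 2 * x × ct + 2 * cy ≡ y
  PhaseInv halve′  b x y cx cy ct = cx ≡ bitℕ b + 2 * x × suc (ct + 2 * cy) ≡ y
  PhaseInv halve″  b x y cx cy ct = cx ≡ bitℕ b + 2 * x × suc (suc (ct + 2 * cy)) ≡ y
  PhaseInv _       b x y cx cy ct = ⊥

  ReadyInv : Fin (suc Q) → Bool → Counters → Set
  ReadyInv q h v = ∃ λ c → ReachedAt q h c × v ≡ tapeCounters c

  InvAt : Fin (suc Q) → Bool → Maybe Move → Phase → Counters → Set
  InvAt q h nothing            p     v = p ≡ ready × ReadyInv q h v
  InvAt q h (just _)           ready v = ReadyInv q h v
  InvAt q h (just (_ , b , d)) p     v = ∃ λ c → ReachedAt q h c × ∃ λ cx → ∃ λ cy → ∃ λ ct →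
                                           v ≡ arrange d cx cy ct × PhaseInv p b (valueX d c) (valueY d c) cx cy ct

  Invariant : State → Counters → Set
  Invariant (q , h , p) v = Halts M ⊎ InvAt q h (δ q h) p v

  readyInvariant : ∀ {q h v} → ReadyInv q h v → Invariant (q , h , ready) v
  readyInvariant {q} {h} inv with δ q h
  ... | nothing = inj₂ (refl , inv)
  ... | just _  = inj₂ inv

  arrange-incrX : ∀ d x y t → incr (counterX d) (arrange d x y t) ≡ arrange d (suc x) y t
  arrange-incrX R _ _ _ = refl
  arrange-incrX L _ _ _ = refl

  arrange-incrY : ∀ d x y t → incr (counterY d) (arrange d x y t) ≡ arrange d x (suc y) t
  arrange-incrY R _ _ _ = refl
  arrange-incrY L _ _ _ = refl

  arrange-incrT : ∀ d x y t → incr tmp (arrange d x y t) ≡ arrange d x y (suc t)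
  arrange-incrT R _ _ _ = refl
  arrange-incrT L _ _ _ = refl

  arrange-getX : ∀ d x y t → get (counterX d) (arrange d x y t) ≡ x
  arrange-getX R _ _ _ = refl
  arrange-getX L _ _ _ = refl

  arrange-getY : ∀ d x y t → get (counterY d) (arrange d x y t) ≡ y
  arrange-getY R _ _ _ = refl
  arrange-getY L _ _ _ = refl

  arrange-getT : ∀ d x y t → get tmp (arrange d x y t) ≡ t
  arrange-getT R _ _ _ = refl
  arrange-getT L _ _ _ = refl

  arrange-decX : ∀ d v x y t → incr (counterX d) v ≡ arrange d x y t → ∃ λ x′ → x ≡ suc x′ × v ≡ arrange d x′ y t
  arrange-decX R (a , b , c) _ _ _ refl = a , refl , refl
  arrange-decX L (a , b , c) _ _ _ refl = b , refl , refl

  arrange-decY : ∀ d v x y t → incr (counterY d) v ≡ arrange d x y t → ∃ λ y′ → y ≡ suc y′ × v ≡ arrange d x y′ t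
  arrange-decY R (a , b , c) _ _ _ refl = b , refl , refl
  arrange-decY L (a , b , c) _ _ _ refl = a , refl , refl

  arrange-decT : ∀ d v x y t → incr tmp v ≡ arrange d x y t → ∃ λ t′ → t ≡ suc t′ × v ≡ arrange d x y t′
  arrange-decT R (a , b , c) _ _ _ refl = c , refl , refl
  arrange-decT L (a , b , c) _ _ _ refl = c , refl , refl

  zeroX : ∀ d {v x y t} → v ≡ arrange d x y t → get (counterX d) v ≡ 0 → x ≡ 0
  zeroX d refl z = trans (sym (arrange-getX d _ _ _)) z

  zeroY : ∀ d {v x y t} → v ≡ arrange d x y t → get (counterY d) v ≡ 0 → y ≡ 0
  zeroY d refl z = trans (sym (arrange-getY d _ _ _)) z

  zeroT : ∀ d {v x y t} → v ≡ arrange d x y t → get tmp v ≡ 0 → t ≡ 0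
  zeroT d refl z = trans (sym (arrange-getT d _ _ _)) z

  bits-injective : ∀ a b x y → bitℕ a + 2 * x ≡ bitℕ b + 2 * y → a ≡ b × x ≡ y
  bits-injective false false x y eq = refl , *-cancelˡ-≡ x y 2 eq
  bits-injective true  true  x y eq = refl , *-cancelˡ-≡ x y 2 (suc-injective eq)
  bits-injective false true  x y eq = ⊥-elim (even≢odd x y eq)
  bits-injective true  false x y eq = ⊥-elim (even≢odd y x (sym eq))

  move-counters : ∀ d (c : Config M) q′ b cx cy h′ → cx ≡ bitℕ b + 2 * valueX d c → bitℕ h′ + 2 * cy ≡ valueY d c →
                  Config.state (move q′ b d c) ≡ q′ × Config.head (move q′ b d c) ≡ h′ ×
                  arrange d cx cy 0 ≡ tapeCounters (move q′ b d c)
  move-counters R (cfg _ l _ [])      q′ b cx cy h′ refl eq with bits-injective h′ false cy 0 eq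
  ... | refl , refl = refl , refl , refl
  move-counters R (cfg _ l _ (z ∷ r)) q′ b cx cy h′ refl eq with bits-injective h′ z cy (value r) eq
  ... | refl , refl = refl , refl , refl
  move-counters L (cfg _ [] _ r)      q′ b cx cy h′ refl eq with bits-injective h′ false cy 0 eq
  ... | refl , refl = refl , refl , refl
  move-counters L (cfg _ (z ∷ l) _ r) q′ b cx cy h′ refl eq with bits-injective h′ z cy (value l) eq
  ... | refl , refl = refl , refl , refl

  iterTM-snoc : ∀ n c₀ {c c′} → iterTM {M} n c₀ ≡ just c → stepTM c ≡ just c′ → iterTM (suc n) c₀ ≡ just c′
  iterTM-snoc zero    c₀ refl step≡ with stepTM c₀
  ... | just _ = step≡
  iterTM-snoc (suc n) c₀ iter≡ step≡ with stepTM c₀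
  ... | just c₁ = iterTM-snoc n c₁ iter≡ step≡

  stepTM-move : ∀ (c : Config M) {q′ b d} → δ (Config.state c) (Config.head c) ≡ just (q′ , b , d) →
                stepTM c ≡ just (move q′ b d c)
  stepTM-move c δ≡ with δ (Config.state c) (Config.head c)
  stepTM-move c refl | _ = refl

  reached-move : ∀ {q h q′ b d c} → δ q h ≡ just (q′ , b , d) → ReachedAt q h c → Reached (move q′ b d c)
  reached-move {c = c} δ≡ ((n , iter≡) , refl , refl) = suc n , iterTM-snoc n (initial M) iter≡ (stepTM-move c δ≡)

  reached-halts : ∀ {q h c} → δ q h ≡ nothing → ReachedAt q h c → Halts M
  reached-halts {c = c} δ≡ ((n , iter≡) , refl , refl) = n , c , iter≡ , δ≡

  stepDone : ∀ {q h q′ b d c v cx cy} h′ → δ q h ≡ just (q′ , b , d) → ReachedAt q h c →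
             v ≡ arrange d cx cy 0 → cx ≡ bitℕ b + 2 * valueX d c → bitℕ h′ + 2 * cy ≡ valueY d c →
             Invariant (q′ , h′ , ready) v
  stepDone {q′ = q′} {b} {d} {c} {cx = cx} {cy} h′ δ≡ at v≡ cx≡ cy≡ with move-counters d c q′ b cx cy h′ cx≡ cy≡
  ... | state≡ , head≡ , counters≡ =
    readyInvariant (move q′ b d c , (reached-move δ≡ at , state≡ , head≡) , trans v≡ counters≡)

  back : ∀ {q h p m v} → δ q h ≡ m → InvAt q h m p v → Invariant (q , h , p) v
  back {q} {h} {p} {v = v} δ≡ inv = inj₂ (subst (λ m → InvAt q h m p v) (sym δ≡) inv)

  m+2[1+n]≡2+[m+2n] : ∀ a n → a + 2 * suc n ≡ suc (suc (a + 2 * n))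
  m+2[1+n]≡2+[m+2n] a n = trans (cong (a +_) (*-suc 2 n)) (trans (+-suc a (suc (2 * n))) (cong suc (+-suc a (2 * n))))

  preserve-move : ∀ {q h q′ b d} p {o st′ v v′} → δ q h ≡ just (q′ , b , d) →
                  (o , st′) ∈ program q h p (just (q′ , b , d)) → Exec o v v′ →
                  InvAt q h (just (q′ , b , d)) p v → Invariant st′ v′
  preserve-move {d = d} ready δ≡ (here refl) (exec-zero _ _ _) (c , at , v≡) =
    back δ≡ (c , at , valueX d c , valueY d c , 0 , trans v≡ (tapeCounters-arrange d c) , +-identityʳ _ , refl)
  preserve-move {d = d} moveX δ≡ (here refl) (exec-dec _ _) (c , at , cx , cy , ct , v≡ , x≡ , y≡)
    with arrange-decX d _ cx cy ct v≡
  ... | cx′ , refl , v′≡ = back δ≡ (c , at , cx′ , cy , ct , v′≡ , x≡ , y≡)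
  preserve-move {d = d} moveX δ≡ (there (here refl)) (exec-zero _ _ z) (c , at , cx , cy , ct , v≡ , x≡ , y≡)
    with zeroX d v≡ z
  ... | refl = back δ≡ (c , at , 0 , cy , ct , v≡ , cong (2 *_) x≡ , y≡)
  preserve-move {d = d} moveX′ δ≡ (here refl) (exec-inc _ _) (c , at , cx , cy , ct , v≡ , x≡ , y≡) =
    back δ≡ (c , at , cx , cy , suc ct , trans (cong (incr tmp) v≡) (arrange-incrT d cx cy ct) ,
             trans (+-suc cx ct) x≡ , y≡)
  preserve-move {d = d} double δ≡ (here refl) (exec-dec _ _) (c , at , cx , cy , ct , v≡ , x≡ , y≡)
    with arrange-decT d _ cx cy ct v≡
  ... | ct′ , refl , v′≡ = back δ≡ (c , at , cx , cy , ct′ , v′≡ , trans (sym (m+2[1+n]≡2+[m+2n] cx ct′)) x≡ , y≡)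
  preserve-move {d = d} double δ≡ (there (here refl)) (exec-zero _ _ z) (c , at , cx , cy , ct , v≡ , x≡ , y≡)
    with zeroT d v≡ z
  ... | refl = back δ≡ (c , at , cx , cy , 0 , v≡ , trans (sym (+-identityʳ cx)) x≡ , refl , y≡)
  preserve-move {d = d} double′ δ≡ (here refl) (exec-inc _ _) (c , at , cx , cy , ct , v≡ , x≡ , y≡) =
    back δ≡ (c , at , suc cx , cy , ct , trans (cong (incr (counterX d)) v≡) (arrange-incrX d cx cy ct) , x≡ , y≡)
  preserve-move {d = d} double″ δ≡ (here refl) (exec-inc _ _) (c , at , cx , cy , ct , v≡ , x≡ , y≡) =
    back δ≡ (c , at , suc cx , cy , ct , trans (cong (incr (counterX d)) v≡) (arrange-incrX d cx cy ct) , x≡ , y≡)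
  preserve-move {b = true} {d} write δ≡ (here refl) (exec-inc _ _) (c , at , cx , cy , _ , v≡ , x≡ , refl , y≡) =
    back δ≡ (c , at , suc cx , cy , 0 , trans (cong (incr (counterX d)) v≡) (arrange-incrX d cx cy 0) ,
             cong suc x≡ , trans (+-identityʳ cy) y≡)
  preserve-move {b = false} write δ≡ (here refl) (exec-zero _ _ _) (c , at , cx , cy , _ , v≡ , x≡ , refl , y≡) =
    back δ≡ (c , at , cx , cy , 0 , v≡ , x≡ , trans (+-identityʳ cy) y≡)
  preserve-move {d = d} moveY δ≡ (here refl) (exec-dec _ _) (c , at , cx , cy , ct , v≡ , x≡ , y≡)
    with arrange-decY d _ cx cy ct v≡
  ... | cy′ , refl , v′≡ = back δ≡ (c , at , cx , cy′ , ct , v′≡ , x≡ , y≡)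
  preserve-move {d = d} moveY δ≡ (there (here refl)) (exec-zero _ _ z) (c , at , cx , cy , ct , v≡ , x≡ , y≡)
    with zeroY d v≡ z
  ... | refl = back δ≡ (c , at , cx , 0 , ct , v≡ , x≡ , trans (+-identityʳ ct) y≡)
  preserve-move {d = d} moveY′ δ≡ (here refl) (exec-inc _ _) (c , at , cx , cy , ct , v≡ , x≡ , y≡) =
    back δ≡ (c , at , cx , cy , suc ct , trans (cong (incr tmp) v≡) (arrange-incrT d cx cy ct) ,
             x≡ , trans (+-suc cy ct) y≡)
  preserve-move {d = d} halve δ≡ (here refl) (exec-dec _ _) (c , at , cx , cy , ct , v≡ , x≡ , y≡)
    with arrange-decT d _ cx cy ct v≡
  ... | ct′ , refl , v′≡ = back δ≡ (c , at , cx , cy , ct′ , v′≡ , x≡ , y≡)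
  preserve-move {d = d} halve δ≡ (there (here refl)) (exec-zero _ _ z) (c , at , cx , cy , ct , v≡ , x≡ , y≡)
    with zeroT d v≡ z
  ... | refl = stepDone false δ≡ at v≡ x≡ y≡
  preserve-move {d = d} halve′ δ≡ (here refl) (exec-dec _ _) (c , at , cx , cy , ct , v≡ , x≡ , y≡)
    with arrange-decT d _ cx cy ct v≡
  ... | ct′ , refl , v′≡ = back δ≡ (c , at , cx , cy , ct′ , v′≡ , x≡ , y≡)
  preserve-move {d = d} halve′ δ≡ (there (here refl)) (exec-zero _ _ z) (c , at , cx , cy , ct , v≡ , x≡ , y≡)
    with zeroT d v≡ z
  ... | refl = stepDone true δ≡ at v≡ x≡ y≡
  preserve-move {d = d} halve″ δ≡ (here refl) (exec-inc _ _) (c , at , cx , cy , ct , v≡ , x≡ , y≡) =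
    back δ≡ (c , at , cx , suc cy , ct , trans (cong (incr (counterY d)) v≡) (arrange-incrY d cx cy ct) , x≡ ,
             trans (m+2[1+n]≡2+[m+2n] ct cy) y≡)
  preserve-move drain    _ _ _ (_ , _ , _ , _ , _ , _ , ())
  preserve-move finished _ () _ _

  preserve : ∀ st {o st′ v v′} → (o , st′) ∈ next st → Exec o v v′ → Invariant st v → Invariant st′ v′
  preserve _ {st′ = _ , _ , _} _ _ (inj₁ halts) = inj₁ halts
  preserve (q , h , p) m e (inj₂ inv) with δ q h in δ≡
  ... | just _ = preserve-move p δ≡ m e inv
  ... | nothing with inv
  ...   | refl , _ , at , _ = inj₁ (reached-halts δ≡ at)

  run-invariant : ∀ {s v s′ v′ W} → Run s v s′ v′ W → Invariant (decode s) v → Invariant (decode s′) v′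
  run-invariant done                inv = inv
  run-invariant (t ∷⟨ e ⟩ r) inv = run-invariant r (preserve _ (transition⁻ t) e inv)

  -- a finished state is only reachable through the halting branch
  run⇒halts : ∀ {s v W} → Run (encode (fzero , false , ready)) zeros s v W →
              T (isFinished (proj₂ (proj₂ (decode s)))) → Halts M
  run⇒halts {s} r fin = finishedHalts (decode s) fin
    (run-invariant r (subst (λ st → Invariant st zeros) (sym (decode-encode (fzero , false , ready)))
                            (readyInvariant (initial M , ((0 , refl) , refl , refl) , refl))))
    where
    finishedHalts : ∀ st → T (isFinished (proj₂ (proj₂ st))) → Invariant st _ → Halts M
    finishedHalts (_ , _ , finished) _ (inj₁ halts) = halts
    finishedHalts (q , h , finished) _ (inj₂ inv)   = ⊥-elim (notFinished (δ q h) inv)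
      where
      notFinished : ∀ m {v} → ¬ InvAt q h m finished v
      notFinished nothing  (() , _)
      notFinished (just _) (_ , _ , _ , _ , _ , _ , ())

  Reaches : Fin nS → Counters → Fin nS → Counters → Set
  Reaches s v s′ v′ = ∃ λ W → Run s v s′ v′ W

  infixr 5 _▹_
  _▹_ : ∀ {s v s₁ v₁ s₂ v₂} → Reaches s v s₁ v₁ → Reaches s₁ v₁ s₂ v₂ → Reaches s v s₂ v₂
  (W₁ , r₁) ▹ (W₂ , r₂) = W₁ ++ W₂ , r₁ ++ᵣ r₂

  stay : ∀ {s v} → Reaches s v s v
  stay = [] , done

  transit : ∀ st {st′ o v v′} → (o , st′) ∈ next st → Exec o v v′ → Reaches (encode st) v (encode st′) v′
  transit st {o = o} m e = o ∷ [] , transition⁺ st m ∷⟨ e ⟩ done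

  from≡ : ∀ {s v₁ v₂ s′ v′} → v₁ ≡ v₂ → Reaches s v₁ s′ v′ → Reaches s v₂ s′ v′
  from≡ refl r = r

  to≡ : ∀ {s v s′ v₁ v₂} → v₁ ≡ v₂ → Reaches s v s′ v₁ → Reaches s v s′ v₂
  to≡ refl r = r

  toState≡ : ∀ {s v s₁ s₂ v′} → s₁ ≡ s₂ → Reaches s v s₁ v′ → Reaches s v s₂ v′
  toState≡ refl r = r

  module MoveStep (q : Fin (suc Q)) (h : Bool) (q′ : Fin (suc Q)) (b : Bool) (d : Dir)
                  (δ≡ : δ q h ≡ just (q′ , b , d)) where

    inPhase : Phase → State
    inPhase p = q , h , p

    _⟨_⟩⇝⟨_⟩_ : Phase → Counters → Counters → Phase → Set
    p ⟨ v ⟩⇝⟨ v′ ⟩ p′ = Reaches (encode (inPhase p)) v (encode (inPhase p′)) v′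

    goFrom : ∀ p {o st′ v v′} → (o , st′) ∈ program q h p (just (q′ , b , d)) → Exec o v v′ →
           Reaches (encode (inPhase p)) v (encode st′) v′
    goFrom p {o} {st′} m = transit (inPhase p) (subst (λ mv → (o , st′) ∈ program q h p mv) (sym δ≡) m)

    decX : ∀ x y t → Exec (dec (counterX d)) (arrange d (suc x) y t) (arrange d x y t)
    decX x y t = subst (λ v → Exec _ v (arrange d x y t)) (arrange-incrX d x y t) (exec-dec _ _)
    decY : ∀ x y t → Exec (dec (counterY d)) (arrange d x (suc y) t) (arrange d x y t)
    decY x y t = subst (λ v → Exec _ v (arrange d x y t)) (arrange-incrY d x y t) (exec-dec _ _)
    decT : ∀ x y t → Exec (dec tmp) (arrange d x y (suc t)) (arrange d x y t)
    decT x y t = subst (λ v → Exec _ v (arrange d x y t)) (arrange-incrT d x y t) (exec-dec _ _)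
    incX : ∀ x y t → Exec (inc (counterX d)) (arrange d x y t) (arrange d (suc x) y t)
    incX x y t = subst (Exec _ _) (arrange-incrX d x y t) (exec-inc _ _)
    incY : ∀ x y t → Exec (inc (counterY d)) (arrange d x y t) (arrange d x (suc y) t)
    incY x y t = subst (Exec _ _) (arrange-incrY d x y t) (exec-inc _ _)
    incT : ∀ x y t → Exec (inc tmp) (arrange d x y t) (arrange d x y (suc t))
    incT x y t = subst (Exec _ _) (arrange-incrT d x y t) (exec-inc _ _)
    zeroX? : ∀ y t → Exec (zero? (counterX d)) (arrange d 0 y t) (arrange d 0 y t)
    zeroX? y t = exec-zero _ _ (arrange-getX d 0 y t)
    zeroY? : ∀ x t → Exec (zero? (counterY d)) (arrange d x 0 t) (arrange d x 0 t)
    zeroY? x t = exec-zero _ _ (arrange-getY d x 0 t)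
    zeroT? : ∀ x y → Exec (zero? tmp) (arrange d x y 0) (arrange d x y 0)
    zeroT? x y = exec-zero _ _ (arrange-getT d x y 0)

    loopMoveX : ∀ k x y t →
                moveX ⟨ arrange d (k + x) y t ⟩⇝⟨ arrange d x y (k + t) ⟩ moveX
    loopMoveX zero    x y t = stay
    loopMoveX (suc k) x y t =
      goFrom moveX (here refl) (decX (k + x) y t) ▹ goFrom moveX′ (here refl) (incT (k + x) y t) ▹
      to≡ (cong (arrange d x y) (+-suc k t)) (loopMoveX k x y (suc t))

    loopDouble : ∀ k x y t →
                 double ⟨ arrange d x y (k + t) ⟩⇝⟨ arrange d (2 * k + x) y t ⟩ double
    loopDouble zero    x y t = stay
    loopDouble (suc k) x y t =
      goFrom double (here refl) (decT x y (k + t)) ▹ goFrom double′ (here refl) (incX x y (k + t)) ▹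
      goFrom double″ (here refl) (incX (suc x) y (k + t)) ▹
      to≡ (cong (λ x′ → arrange d x′ y t) (sym (2[1+k]+x≡2k+[2+x] k x))) (loopDouble k (suc (suc x)) y t)
      where
      2[1+k]+x≡2k+[2+x] : ∀ k x → 2 * suc k + x ≡ 2 * k + suc (suc x)
      2[1+k]+x≡2k+[2+x] k x =
        trans (cong (_+ x) (*-suc 2 k)) (sym (trans (+-suc (2 * k) (suc x)) (cong suc (+-suc (2 * k) x))))

    loopMoveY : ∀ k x y t →
                moveY ⟨ arrange d x (k + y) t ⟩⇝⟨ arrange d x y (k + t) ⟩ moveY
    loopMoveY zero    x y t = stay
    loopMoveY (suc k) x y t =
      goFrom moveY (here refl) (decY x (k + y) t) ▹ goFrom moveY′ (here refl) (incT x (k + y) t) ▹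
      to≡ (cong (arrange d x y) (+-suc k t)) (loopMoveY k x y (suc t))

    loopHalve : ∀ k x y t →
                halve ⟨ arrange d x y (2 * k + t) ⟩⇝⟨ arrange d x (k + y) t ⟩ halve
    loopHalve zero    x y t = stay
    loopHalve (suc k) x y t = from≡ (cong (arrange d x y) (sym (cong (_+ t) (*-suc 2 k))))
      (goFrom halve (here refl) (decT x y (suc (2 * k + t))) ▹ goFrom halve′ (here refl) (decT x y (2 * k + t)) ▹
       goFrom halve″ (here refl) (incY x y (2 * k + t)) ▹
       to≡ (cong (λ y′ → arrange d x y′ t) (+-suc k y)) (loopHalve k x (suc y) t))

    writeBit : ∀ b′ → b ≡ b′ → ∀ x y →
               write ⟨ arrange d (2 * x) y 0 ⟩⇝⟨ arrange d (bitℕ b′ + 2 * x) y 0 ⟩ moveY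
    writeBit true  refl x y = goFrom write (here refl) (incX (2 * x) y 0)
    writeBit false refl x y = goFrom write (here refl) (zeroT? (2 * x) y)

    updateX : ∀ x y →
              ready ⟨ arrange d x y 0 ⟩⇝⟨ arrange d (bitℕ b + 2 * x) y 0 ⟩ moveY
    updateX x y =
      goFrom ready (here refl) (zeroT? x y) ▹
      from≡ (cong (λ z → arrange d z y 0) (+-identityʳ x)) (loopMoveX x 0 y 0) ▹
      goFrom moveX (there (here refl)) (zeroX? y (x + 0)) ▹
      loopDouble x 0 y 0 ▹
      goFrom double (there (here refl)) (zeroT? (2 * x + 0) y) ▹
      from≡ (cong (λ z → arrange d z y 0) (sym (+-identityʳ (2 * x)))) (writeBit b refl x y)

    updateY : ∀ cx h′ k → Reaches (encode (inPhase moveY)) (arrange d cx (bitℕ h′ + 2 * k) 0)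
                                  (encode (q′ , h′ , ready)) (arrange d cx k 0)
    updateY cx h′ k =
      from≡ (cong (λ z → arrange d cx z 0) (+-identityʳ y)) (loopMoveY y cx 0 0) ▹
      goFrom moveY (there (here refl)) (zeroY? cx (y + 0)) ▹
      from≡ (cong (arrange d cx 0) (trans (+-comm (2 * k) (bitℕ h′)) (sym (+-identityʳ y))))
            (loopHalve k cx 0 (bitℕ h′)) ▹
      to≡ (cong (λ z → arrange d cx z 0) (+-identityʳ k)) (finish h′)
      where
      y : ℕ
      y = bitℕ h′ + 2 * k
      finish : ∀ h′ → Reaches (encode (inPhase halve)) (arrange d cx (k + 0) (bitℕ h′))
                              (encode (q′ , h′ , ready)) (arrange d cx (k + 0) 0)
      finish false = goFrom halve (there (here refl)) (zeroT? cx (k + 0))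
      finish true  = goFrom halve (here refl) (decT cx (k + 0) 0) ▹
                     goFrom halve′ (there (here refl)) (zeroT? cx (k + 0))

  readyAt : Config M → State
  readyAt c = Config.state c , Config.head c , ready

  tapeY-bits : ∀ d (c : Config M) → ∃₂ λ h′ k → bitℕ h′ + 2 * k ≡ valueY d c
  tapeY-bits R (cfg _ _ _ [])      = false , 0 , refl
  tapeY-bits R (cfg _ _ _ (z ∷ r)) = z , value r , refl
  tapeY-bits L (cfg _ [] _ _)      = false , 0 , refl
  tapeY-bits L (cfg _ (z ∷ l) _ _) = z , value l , refl

  simulateStep : ∀ (c : Config M) {q′ b d} → δ (Config.state c) (Config.head c) ≡ just (q′ , b , d) →
                 Reaches (encode (readyAt c)) (tapeCounters c)
                         (encode (readyAt (move q′ b d c))) (tapeCounters (move q′ b d c))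
  simulateStep c {q′} {b} {d} δ≡ with tapeY-bits d c
  ... | h′ , k , y≡ with move-counters d c q′ b (bitℕ b + 2 * valueX d c) k h′ refl y≡
  ...   | state≡ , head≡ , counters≡ =
    from≡ (sym (tapeCounters-arrange d c))
      (toState≡ (cong encode (cong₂ (λ q h → q , h , ready) (sym state≡) (sym head≡)))
        (to≡ counters≡
          (updateX (valueX d c) (valueY d c) ▹
           from≡ (cong (λ z → arrange d (bitℕ b + 2 * valueX d c) z 0) y≡) (updateY _ h′ k))))
    where open MoveStep (Config.state c) (Config.head c) q′ b d δ≡

  simulateRun : ∀ n (c₀ c : Config M) → iterTM n c₀ ≡ just c →
                Reaches (encode (readyAt c₀)) (tapeCounters c₀) (encode (readyAt c)) (tapeCounters c)
  simulateRun zero    c₀ c refl = stay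
  simulateRun (suc n) c₀ c iter≡ with δ (Config.state c₀) (Config.head c₀) in δ≡
  ... | just (q′ , b , d) = simulateStep c₀ δ≡ ▹ simulateRun n _ c iter≡
  ... | nothing           = case iter≡ of λ ()

  module Halting (c : Config M) (δ≡ : δ (Config.state c) (Config.head c) ≡ nothing) where
    q : Fin (suc Q)
    q = Config.state c
    h : Bool
    h = Config.head c

    goFrom : ∀ p {o st′ v v′} → (o , st′) ∈ program q h p nothing → Exec o v v′ →
             Reaches (encode (q , h , p)) v (encode st′) v′
    goFrom p {o} {st′} m = transit (q , h , p) (subst (λ mv → (o , st′) ∈ program q h p mv) (sym δ≡) m)

    drainLeft : ∀ k r → Reaches (encode (q , h , ready)) (k + 0 , r , 0) (encode (q , h , ready)) (0 , r , 0)
    drainLeft zero    r = stay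
    drainLeft (suc k) r = goFrom ready (here refl) (exec-dec left (k + 0 , r , 0)) ▹ drainLeft k r

    drainRight : ∀ k → Reaches (encode (q , h , drain)) (0 , k + 0 , 0) (encode (q , h , drain)) zeros
    drainRight zero    = stay
    drainRight (suc k) = goFrom drain (here refl) (exec-dec right (0 , k + 0 , 0)) ▹ drainRight k

    toDrain : Reaches (encode (readyAt c)) (tapeCounters c) (encode (q , h , drain)) zeros
    toDrain = from≡ (cong (λ x → x , value (Config.right c) , 0) (+-identityʳ _))
                    (drainLeft (value (Config.left c)) _) ▹
              goFrom ready (there (here refl)) (exec-zero left _ refl) ▹
              from≡ (cong (λ y → 0 , y , 0) (+-identityʳ _)) (drainRight (value (Config.right c)))

    finish : Run (encode (q , h , drain)) zeros (encode (q , h , finished)) zeros (zero? right ∷ [])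
    finish = transition⁺ (q , h , drain) (there (here refl)) ∷⟨ exec-zero right zeros refl ⟩ done

  isFinal-finished : ∀ q h → T (CounterMachine.final machine (encode (q , h , finished)))
  isFinal-finished q h = subst (T ∘ isFinished ∘ proj₂ ∘ proj₂) (sym (decode-encode (q , h , finished))) tt

  ++-∷-nonEmpty : ∀ {A : Set} (xs : List A) {y ys} → ∃₂ λ z zs → xs ++ y ∷ ys ≡ z ∷ zs
  ++-∷-nonEmpty []       = _ , _ , refl
  ++-∷-nonEmpty (x ∷ xs) = x , _ , refl

  halts⇒nonEmpty : Halts M → NonEmptyLang hmsc
  halts⇒nonEmpty (n , c , iter≡ , δ≡) = accept (simulateRun n (initial M) c iter≡ ▹ toDrain)
    where
    open Halting c δ≡
    accept : Reaches (encode (readyAt (initial M))) zeros (encode (q , h , drain)) zeros → NonEmptyLang hmsc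
    accept (W , r) with ++-∷-nonEmpty W {zero? right} {[]}
    ... | o , os , W≡ = accepting-run⇒nonEmpty (subst (Run _ zeros _ zeros) W≡ (r ++ᵣ finish)) (isFinal-finished q h)

  nonEmpty⇒halts : NonEmptyLang hmsc → Halts M
  nonEmpty⇒halts ne with nonEmpty⇒accepting-run ne
  ... | _ , _ , _ , r , final-s = run⇒halts r final-s

theorem5 : Σ (TM → Instance) λ f → ∀ M → Halts M ⇔ HMSCNonEmpty (f M)
theorem5 = (λ M → 5 , Machine.hmsc (Simulation.machine M)) ,
           λ M → mk⇔ (Simulation.halts⇒nonEmpty M) (Simulation.nonEmpty⇒halts M)
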